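{- There is a centrally symmetric set $P\subset\mathbb{Z}^2$ of exactly $96$ points ($P=-P$), with no three points of $P$ collinear, which has no orthogonal $8$-partition: $P$ cannot be partitioned into four cyclically ordered classes of sizes $8,8,40,40$ separated by two perpendicular lines. This remains true under the weak convention in which points lying on either cutting line may be assigned arbitrarily to adjacent sectors: for every pair of perpendicular lines in $\mathbb{R}^2$ and every assignment of the points of $P$ to the four sectors such that each point is assigned to a sector whose closure contains it, the numbers of points assigned to the four sectors are not, in any cyclic order of the sectors, equal to $8,8,40,40$.
   Context: For a set $P$ of $N=2m$ points in $\mathbb{R}^2$ and an integer $0\le k\le N/4$, an orthogonal $k$-partition is a partition of $P$ into four cyclically ordered classes of sizes $k,k,m-k,m-k$ separated by two perpendicular lines, that is, the classes are the sets of points of $P$ in the four sectors determined by the lines, in cyclic order around their intersection. In the strict sense the two lines avoid all points of $P$; in the weak sense points on the lines are allowed and each may be assigned to any of its incident sectors. Here $m=48$, $k=8$. -}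

module Defs where

open import Data.Nat.Base as ℕ using (ℕ; _∸_; _⊔_)
import Data.Nat.Properties as ℕ
open import Data.Integer.Base as ℤ using (ℤ)
open import Data.Rational as ℚ using (ℚ; 0ℚ; 1ℚ; ½; ∣_∣)
import Data.Rational.Properties as ℚ
open import Data.Rational.Solver using (module +-*-Solver)
open import Data.List.Base using (List; length; filter)
open import Data.List.Membership.Propositional using (_∈_)
open import Data.Product.Base using (_×_; _,_; ∃; ∃-syntax; proj₁; proj₂)
open import Relation.Nullary using (¬_; Dec; yes; no)
open import Relation.Binary.PropositionalEquality
  using (_≡_; _≢_; refl; sym; trans; cong; subst; module ≡-Reasoning)

-- Reals are Cauchy sequences of rationals, taken up to _≈_.
IsCauchy : (ℕ → ℚ) → Set
IsCauchy x = ∀ ε → 0ℚ ℚ.< ε →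
  ∃[ N ] (∀ m n → N ℕ.≤ m → N ℕ.≤ n → ∣ x m ℚ.- x n ∣ ℚ.< ε)

record ℝ : Set where
  constructor mkℝ
  field
    seq    : ℕ → ℚ
    cauchy : IsCauchy seq

open ℝ public

infix 4 _≈_ _<_ _≤_

_≈_ : ℝ → ℝ → Set
x ≈ y = ∀ ε → 0ℚ ℚ.< ε →
  ∃[ N ] (∀ n → N ℕ.≤ n → ∣ seq x n ℚ.- seq y n ∣ ℚ.< ε)

_<_ : ℝ → ℝ → Set
x < y = ∃[ ε ] (0ℚ ℚ.< ε × ∃[ N ] (∀ n → N ℕ.≤ n → seq x n ℚ.+ ε ℚ.≤ seq y n))

_≤_ : ℝ → ℝ → Set
x ≤ y = ¬ (y < x)

fromℚ : ℚ → ℝ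
fromℚ q = mkℝ (λ _ → q) λ ε 0<ε → 0 , λ _ _ _ _ →
  subst (λ t → ∣ t ∣ ℚ.< ε) (sym (ℚ.+-inverseʳ q)) 0<ε

fromℤ : ℤ → ℝ
fromℤ i = fromℚ (i ℚ./ 1)

0ℝ : ℝ
0ℝ = fromℚ 0ℚ

private
  open +-*-Solver using (solve; _:=_; _:+_; _:*_; _:-_; :-_)

  +-rearrange : ∀ a b c d → (a ℚ.+ b) ℚ.- (c ℚ.+ d) ≡ (a ℚ.- c) ℚ.+ (b ℚ.- d)
  +-rearrange = solve 4 (λ a b c d → (a :+ b) :- (c :+ d) := (a :- c) :+ (b :- d)) refl

  neg-rearrange : ∀ a b → ℚ.- (a ℚ.- b) ≡ ℚ.- a ℚ.- ℚ.- b
  neg-rearrange = solve 2 (λ a b → :- (a :- b) := :- a :- :- b) refl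

  add-back : ∀ a b → a ≡ b ℚ.+ (a ℚ.- b)
  add-back = solve 2 (λ a b → a := b :+ (a :- b)) refl

  *-rearrange : ∀ a b c d →
    a ℚ.* b ℚ.- c ℚ.* d ≡ a ℚ.* (b ℚ.- d) ℚ.+ d ℚ.* (a ℚ.- c)
  *-rearrange = solve 4 (λ a b c d →
    a :* b :- c :* d := a :* (b :- d) :+ d :* (a :- c)) refl

  half+half : ∀ ε → ε ℚ.* ½ ℚ.+ ε ℚ.* ½ ≡ ε
  half+half ε = trans (sym (ℚ.*-distribˡ-+ ε ½ ½)) (ℚ.*-identityʳ ε)

  half-pos : ∀ {ε} → 0ℚ ℚ.< ε → 0ℚ ℚ.< ε ℚ.* ½
  half-pos = ℚ.*-monoˡ-<-pos ½

  +-cauchy : ∀ {x y} → IsCauchy x → IsCauchy y → IsCauchy (λ n → x n ℚ.+ y n)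
  +-cauchy {x} {y} cx cy ε 0<ε = N ⊔ M , λ m n p q → begin-strict
      ∣ (x m ℚ.+ y m) ℚ.- (x n ℚ.+ y n) ∣
    ≡⟨ cong ∣_∣ (+-rearrange (x m) (y m) (x n) (y n)) ⟩
      ∣ (x m ℚ.- x n) ℚ.+ (y m ℚ.- y n) ∣
    ≤⟨ ℚ.∣p+q∣≤∣p∣+∣q∣ (x m ℚ.- x n) (y m ℚ.- y n) ⟩
      ∣ x m ℚ.- x n ∣ ℚ.+ ∣ y m ℚ.- y n ∣
    <⟨ ℚ.+-mono-< (hx m n (ℕ.m⊔n≤o⇒m≤o N M p) (ℕ.m⊔n≤o⇒m≤o N M q))
                  (hy m n (ℕ.m⊔n≤o⇒n≤o N M p) (ℕ.m⊔n≤o⇒n≤o N M q)) ⟩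
      ε ℚ.* ½ ℚ.+ ε ℚ.* ½
    ≡⟨ half+half ε ⟩
      ε ∎
    where
    open ℚ.≤-Reasoning
    N  = proj₁ (cx (ε ℚ.* ½) (half-pos 0<ε))
    hx = proj₂ (cx (ε ℚ.* ½) (half-pos 0<ε))
    M  = proj₁ (cy (ε ℚ.* ½) (half-pos 0<ε))
    hy = proj₂ (cy (ε ℚ.* ½) (half-pos 0<ε))

  neg-cauchy : ∀ {x} → IsCauchy x → IsCauchy (λ n → ℚ.- x n)
  neg-cauchy {x} cx ε 0<ε = proj₁ (cx ε 0<ε) , λ m n p q →
    subst (ℚ._< ε)
      (trans (sym (ℚ.∣-p∣≡∣p∣ (x m ℚ.- x n)))
             (cong ∣_∣ (neg-rearrange (x m) (x n))))
      (proj₂ (cx ε 0<ε) m n p q)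

  Bounded : (ℕ → ℚ) → Set
  Bounded x = ∃[ B ] (0ℚ ℚ.< B × ∃[ N ] (∀ n → N ℕ.≤ n → ∣ x n ∣ ℚ.≤ B))

  cauchy⇒bounded : ∀ {x} → IsCauchy x → Bounded x
  cauchy⇒bounded {x} cx = ∣ x N ∣ ℚ.+ 1ℚ , 0<B , N , λ n p → begin
      ∣ x n ∣
    ≡⟨ cong ∣_∣ (add-back (x n) (x N)) ⟩
      ∣ x N ℚ.+ (x n ℚ.- x N) ∣
    ≤⟨ ℚ.∣p+q∣≤∣p∣+∣q∣ (x N) (x n ℚ.- x N) ⟩
      ∣ x N ∣ ℚ.+ ∣ x n ℚ.- x N ∣
    ≤⟨ ℚ.+-monoʳ-≤ ∣ x N ∣ (ℚ.<⇒≤ (h n N p ℕ.≤-refl)) ⟩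
      ∣ x N ∣ ℚ.+ 1ℚ ∎
    where
    open ℚ.≤-Reasoning
    0<1 : 0ℚ ℚ.< 1ℚ
    0<1 = ℚ.positive⁻¹ 1ℚ
    N = proj₁ (cx 1ℚ 0<1)
    h = proj₂ (cx 1ℚ 0<1)
    0<B : 0ℚ ℚ.< ∣ x N ∣ ℚ.+ 1ℚ
    0<B = ℚ.+-mono-≤-< (ℚ.0≤∣p∣ (x N)) 0<1

  *-mono-∣∣ : ∀ {p q b d} → 0ℚ ℚ.< b → ∣ p ∣ ℚ.≤ b → ∣ q ∣ ℚ.< d →
              ∣ p ℚ.* q ∣ ℚ.< b ℚ.* d
  *-mono-∣∣ {p} {q} {b} {d} 0<b p≤b q<d = begin-strict
      ∣ p ℚ.* q ∣
    ≡⟨ ℚ.∣p*q∣≡∣p∣*∣q∣ p q ⟩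
      ∣ p ∣ ℚ.* ∣ q ∣
    ≤⟨ ℚ.*-monoʳ-≤-nonNeg ∣ q ∣ {{ℚ.∣-∣-nonNeg q}} p≤b ⟩
      b ℚ.* ∣ q ∣
    <⟨ ℚ.*-monoʳ-<-pos b {{ℚ.positive 0<b}} q<d ⟩
      b ℚ.* d ∎
    where open ℚ.≤-Reasoning

  split : ∀ {B C ε} → 0ℚ ℚ.< B → 0ℚ ℚ.< C → 0ℚ ℚ.< ε →
          ∃[ δ ] (0ℚ ℚ.< δ × B ℚ.* δ ℚ.+ C ℚ.* δ ≡ ε)
  split {B} {C} {ε} 0<B 0<C 0<ε = δ , 0<δ , (begin
      B ℚ.* δ ℚ.+ C ℚ.* δ       ≡⟨ ℚ.*-distribʳ-+ δ B C ⟨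
      D ℚ.* δ                   ≡⟨ ℚ.*-assoc D (ℚ.1/ D) ε ⟨
      D ℚ.* ℚ.1/ D ℚ.* ε        ≡⟨ cong (ℚ._* ε) (ℚ.*-inverseʳ D) ⟩
      1ℚ ℚ.* ε                  ≡⟨ ℚ.*-identityˡ ε ⟩
      ε                         ∎)
    where
    open ≡-Reasoning
    D : ℚ
    D = B ℚ.+ C
    instance
      D-pos : ℚ.Positive D
      D-pos = ℚ.pos+pos⇒pos B {{ℚ.positive 0<B}} C {{ℚ.positive 0<C}}
      D-nonZero : ℚ.NonZero D
      D-nonZero = ℚ.pos⇒nonZero D
    δ : ℚ
    δ = ℚ.1/ D ℚ.* ε
    0<δ : 0ℚ ℚ.< δ
    0<δ = ℚ.positive⁻¹ δ
      {{ℚ.pos*pos⇒pos (ℚ.1/ D) {{ℚ.1/pos⇒pos D}} ε {{ℚ.positive 0<ε}}}}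

  *-close : ∀ {a b c d B C δ ε} → 0ℚ ℚ.< B → 0ℚ ℚ.< C → B ℚ.* δ ℚ.+ C ℚ.* δ ≡ ε →
            ∣ a ∣ ℚ.≤ B → ∣ d ∣ ℚ.≤ C → ∣ a ℚ.- c ∣ ℚ.< δ → ∣ b ℚ.- d ∣ ℚ.< δ →
            ∣ a ℚ.* b ℚ.- c ℚ.* d ∣ ℚ.< ε
  *-close {a} {b} {c} {d} {B} {C} {δ} {ε} 0<B 0<C eq a≤B d≤C a-c b-d = begin-strict
      ∣ a ℚ.* b ℚ.- c ℚ.* d ∣
    ≡⟨ cong ∣_∣ (*-rearrange a b c d) ⟩
      ∣ a ℚ.* (b ℚ.- d) ℚ.+ d ℚ.* (a ℚ.- c) ∣
    ≤⟨ ℚ.∣p+q∣≤∣p∣+∣q∣ (a ℚ.* (b ℚ.- d)) (d ℚ.* (a ℚ.- c)) ⟩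
      ∣ a ℚ.* (b ℚ.- d) ∣ ℚ.+ ∣ d ℚ.* (a ℚ.- c) ∣
    <⟨ ℚ.+-mono-< (*-mono-∣∣ {a} {b ℚ.- d} 0<B a≤B b-d) (*-mono-∣∣ {d} {a ℚ.- c} 0<C d≤C a-c) ⟩
      B ℚ.* δ ℚ.+ C ℚ.* δ
    ≡⟨ eq ⟩
      ε ∎
    where open ℚ.≤-Reasoning

  *-cauchy : ∀ {x y} → IsCauchy x → IsCauchy y → IsCauchy (λ n → x n ℚ.* y n)
  *-cauchy {x} {y} cx cy ε 0<ε =
    let B , 0<B , N₁ , hB = cauchy⇒bounded {x} cx
        C , 0<C , N₂ , hC = cauchy⇒bounded {y} cy
        δ , 0<δ , eq      = split 0<B 0<C 0<ε
        N₃ , hx           = cx δ 0<δ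
        N₄ , hy           = cy δ 0<δ
        ge₃ : ∀ {k} → (N₁ ⊔ N₂) ⊔ (N₃ ⊔ N₄) ℕ.≤ k → N₃ ℕ.≤ k
        ge₃ = λ p → ℕ.m⊔n≤o⇒m≤o N₃ N₄ (ℕ.m⊔n≤o⇒n≤o (N₁ ⊔ N₂) (N₃ ⊔ N₄) p)
        ge₄ : ∀ {k} → (N₁ ⊔ N₂) ⊔ (N₃ ⊔ N₄) ℕ.≤ k → N₄ ℕ.≤ k
        ge₄ = λ p → ℕ.m⊔n≤o⇒n≤o N₃ N₄ (ℕ.m⊔n≤o⇒n≤o (N₁ ⊔ N₂) (N₃ ⊔ N₄) p)
    in (N₁ ⊔ N₂) ⊔ (N₃ ⊔ N₄) , λ m n p q →
      *-close {x m} {y m} {x n} {y n} {B} {C} {δ} {ε} 0<B 0<C eq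
        (hB m (ℕ.m⊔n≤o⇒m≤o N₁ N₂ (ℕ.m⊔n≤o⇒m≤o (N₁ ⊔ N₂) (N₃ ⊔ N₄) p)))
        (hC n (ℕ.m⊔n≤o⇒n≤o N₁ N₂ (ℕ.m⊔n≤o⇒m≤o (N₁ ⊔ N₂) (N₃ ⊔ N₄) q)))
        (hx m n (ge₃ p) (ge₃ q))
        (hy m n (ge₄ p) (ge₄ q))

infixl 6 _+_ _-_
infixl 7 _*_
infix  8 -_

_+_ : ℝ → ℝ → ℝ
x + y = mkℝ (λ n → seq x n ℚ.+ seq y n) (+-cauchy {seq x} {seq y} (cauchy x) (cauchy y))

-_ : ℝ → ℝ
- x = mkℝ (λ n → ℚ.- seq x n) (neg-cauchy {seq x} (cauchy x))

_-_ : ℝ → ℝ → ℝ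
x - y = x + (- y)

_*_ : ℝ → ℝ → ℝ
x * y = mkℝ (λ n → seq x n ℚ.* seq y n) (*-cauchy {seq x} {seq y} (cauchy x) (cauchy y))

ℤ² : Set
ℤ² = ℤ × ℤ

-- The line { (x , y) ∣ a x + b y = c } in ℝ².
record Line : Set where
  field
    a b c         : ℝ
    nondegenerate : ¬ (a ≈ 0ℝ × b ≈ 0ℝ)

Perpendicular : Line → Line → Set
Perpendicular ℓ₁ ℓ₂ = Line.a ℓ₁ * Line.a ℓ₂ + Line.b ℓ₁ * Line.b ℓ₂ ≈ 0ℝ

-- Vanishes exactly on the line; its sign tells the two open half-planes apart.
eval : Line → ℤ² → ℝ
eval ℓ (x , y) = a * fromℤ x + b * fromℤ y - c
  where open Line ℓ

_liesOn_ : ℤ² → Line → Set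
p liesOn ℓ = eval ℓ p ≈ 0ℝ

CentrallySymmetric : List ℤ² → Set
CentrallySymmetric P = ∀ {x y} → (x , y) ∈ P → (ℤ.- x , ℤ.- y) ∈ P

NoThreeCollinear : List ℤ² → Set
NoThreeCollinear P = ∀ {p q r} → p ∈ P → q ∈ P → r ∈ P →
  p ≢ q → q ≢ r → p ≢ r →
  ¬ (∃[ ℓ ] (p liesOn ℓ × q liesOn ℓ × r liesOn ℓ))

-- A sector is named by the signs of eval ℓ₁ and eval ℓ₂ on it.
data Sector : Set where
  ⊕⊕ ⊖⊕ ⊖⊖ ⊕⊖ : Sector

-- Cyclic order around the intersection point of the lines.
next : Sector → Sector
next ⊕⊕ = ⊖⊕
next ⊖⊕ = ⊖⊖
next ⊖⊖ = ⊕⊖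
next ⊕⊖ = ⊕⊕

_≟_ : (s t : Sector) → Dec (s ≡ t)
⊕⊕ ≟ ⊕⊕ = yes refl
⊕⊕ ≟ ⊖⊕ = no λ ()
⊕⊕ ≟ ⊖⊖ = no λ ()
⊕⊕ ≟ ⊕⊖ = no λ ()
⊖⊕ ≟ ⊕⊕ = no λ ()
⊖⊕ ≟ ⊖⊕ = yes refl
⊖⊕ ≟ ⊖⊖ = no λ ()
⊖⊕ ≟ ⊕⊖ = no λ ()
⊖⊖ ≟ ⊕⊕ = no λ ()
⊖⊖ ≟ ⊖⊕ = no λ ()
⊖⊖ ≟ ⊖⊖ = yes refl
⊖⊖ ≟ ⊕⊖ = no λ ()
⊕⊖ ≟ ⊕⊕ = no λ ()
⊕⊖ ≟ ⊖⊕ = no λ ()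
⊕⊖ ≟ ⊖⊖ = no λ ()
⊕⊖ ≟ ⊕⊖ = yes refl

InSector : (ℝ → ℝ → Set) → Line → Line → Sector → ℤ² → Set
InSector _≺_ ℓ₁ ℓ₂ ⊕⊕ p = 0ℝ ≺ eval ℓ₁ p × 0ℝ ≺ eval ℓ₂ p
InSector _≺_ ℓ₁ ℓ₂ ⊖⊕ p = eval ℓ₁ p ≺ 0ℝ × 0ℝ ≺ eval ℓ₂ p
InSector _≺_ ℓ₁ ℓ₂ ⊖⊖ p = eval ℓ₁ p ≺ 0ℝ × eval ℓ₂ p ≺ 0ℝ
InSector _≺_ ℓ₁ ℓ₂ ⊕⊖ p = 0ℝ ≺ eval ℓ₁ p × eval ℓ₂ p ≺ 0ℝ

-- As the lines cross, the closure of an open sector is obtained by making both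
-- inequalities weak.
InOpenSector InClosedSector : Line → Line → Sector → ℤ² → Set
InOpenSector   = InSector _<_
InClosedSector = InSector _≤_

-- For duplicate-free P this is the size of the class assigned to s.
classSize : List ℤ² → (ℤ² → Sector) → Sector → ℕ
classSize P σ s = length (filter (λ p → σ p ≟ s) P)

HasSizes : List ℤ² → ℕ → ℕ → (ℤ² → Sector) → Set
HasSizes P m k σ = ∃[ s ]
  ( classSize P σ s ≡ k
  × classSize P σ (next s) ≡ k
  × classSize P σ (next (next s)) ≡ m ∸ k
  × classSize P σ (next (next (next s))) ≡ m ∸ k )

-- P is meant to have 2m points.  Lying in an open sector forces every point
-- off both lines.
HasOrthogonalPartition : List ℤ² → ℕ → ℕ → Set
HasOrthogonalPartition P m k =
  ∃[ ℓ₁ ] ∃[ ℓ₂ ] ∃[ σ ]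
    ( Perpendicular ℓ₁ ℓ₂
    × (∀ {p} → p ∈ P → InOpenSector ℓ₁ ℓ₂ (σ p) p)
    × HasSizes P m k σ )

HasWeakOrthogonalPartition : List ℤ² → ℕ → ℕ → Set
HasWeakOrthogonalPartition P m k =
  ∃[ ℓ₁ ] ∃[ ℓ₂ ] ∃[ σ ]
    ( Perpendicular ℓ₁ ℓ₂
    × (∀ {p} → p ∈ P → InClosedSector ℓ₁ ℓ₂ (σ p) p)
    × HasSizes P m k σ )

{-# OPTIONS --safe #-}
module Submission where

-- Suppose two perpendicular lines give a partition.  Let d be the normal of the line cutting off the
-- two small classes, pointing to their side, and let e be d turned clockwise by a right angle, a
-- normal of the other line, which has 48 points on each side.  If d lies in the cone spanned by g
-- and h, and q is beyond p both in direction g and in direction h, then q is beyond p in direction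
-- d.  So a point p with 16 such q is not among the 16 points on the positive side of the first
-- line; in the same way, with g and h turned by a right angle, a point with 48 such q is not on the
-- positive side of the second line.  The points chosen below are permuted by the quarter turn, so
-- only one quarter of the directions d has to be examined.  It is divided into nine cones, and in
-- each of them fewer than 8 points survive both tests, although the 8 points of the small class on
-- the positive side of both lines must survive.  Only comparisons of points on different sides of a
-- line enter, so points lying on the lines do no harm.

open import Defs
open import Data.Empty using (⊥)
open import Data.Integer.Base as ℤ using (ℤ; 0ℤ; +_)
import Data.Integer.Properties as ℤ
import Data.Integer.Solver as ℤ
open import Data.List.Base using (List; []; _∷_; _++_; filter; length; map)
open import Data.List.Membership.Propositional using (_∈_)
open import Data.List.Membership.Propositional.Properties using (∈-map⁺)
open import Data.List.Properties using (++-assoc; map-++; map-∘; map-id; map-cong)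
open import Data.List.Relation.Binary.Permutation.Propositional using (_↭_; ↭-trans; ↭-reflexive)
open import Data.List.Relation.Binary.Permutation.Propositional.Properties
  using (++-comm; filter-↭; ↭-length; ∈-resp-↭)
open import Data.List.Relation.Unary.All as All using ([]; _∷_)
open import Data.List.Relation.Unary.AllPairs as AllPairs using (AllPairs; []; _∷_; allPairs?)
open import Data.List.Relation.Unary.Any using (here; there)
open import Data.List.Relation.Unary.Unique.Propositional using (Unique)
open import Data.Nat.Base as ℕ using (ℕ; suc; s≤s; z≤n; _⊔_)
import Data.Nat.Properties as ℕ
open import Data.Product.Base using (_×_; _,_; ∃-syntax; proj₁; proj₂)
open import Data.Product.Properties using (≡-dec)
open import Data.Rational as ℚ using (ℚ; 0ℚ; 1ℚ; ½; ∣_∣)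
import Data.Rational.Properties as ℚ
import Data.Rational.Solver as ℚ
import Data.Rational.Unnormalised.Base as ℚᵘ
import Data.Rational.Unnormalised.Properties as ℚᵘ
open import Data.Sum.Base using (_⊎_; inj₁; inj₂)
open import Data.Unit.Base using (⊤; tt)
open import Function.Base using (_∘_; case_of_)
open import Level using (0ℓ)
open import Relation.Binary.Construct.Closure.Transitive using (TransClosure; [_]; _∷_)
open import Relation.Binary.Definitions using (tri<; tri≈; tri>)
open import Relation.Binary.PropositionalEquality
open import Relation.Nullary using (¬_; Dec; yes; no; contradiction)
open import Relation.Nullary.Decidable
  using (decidable-stable; from-yes; map′; ¬?; _×-dec_; _⊎-dec_)
open import Relation.Unary using (Pred; Decidable)

-- Integer vectors and their quarter turns

rot unrot : ℤ² → ℤ²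
rot   (x , y) = ℤ.- y , x
unrot (x , y) = y , ℤ.- x

infixl 6 _⊟_
_⊟_ : ℤ² → ℤ² → ℤ²
(x , y) ⊟ (z , w) = x ℤ.- z , y ℤ.- w

dot cross : ℤ² → ℤ² → ℤ
dot   (x , y) (z , w) = x ℤ.* z ℤ.+ y ℤ.* w
cross (x , y) (z , w) = x ℤ.* w ℤ.- y ℤ.* z

cross-rot : ∀ g h → cross (rot g) (rot h) ≡ cross g h
cross-rot (x , y) (z , w) = solve 4 (λ x y z w → :- y :* z :- x :* :- w := x :* w :- y :* z) refl x y z w
  where open ℤ.+-*-Solver

cross-antisym : ∀ g h → ℤ.- cross g h ≡ cross h g
cross-antisym (x , y) (z , w) = solve 4 (λ x y z w → :- (x :* w :- y :* z) := z :* y :- w :* x) refl x y z w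
  where open ℤ.+-*-Solver

dot-rot : ∀ g v → dot (rot g) (rot v) ≡ dot g v
dot-rot (x , y) (z , w) = solve 4 (λ x y z w → :- y :* :- w :+ x :* z := x :* z :+ y :* w) refl x y z w
  where open ℤ.+-*-Solver

dot-⊟ : ∀ g p q → dot g (q ⊟ p) ≡ dot g q ℤ.- dot g p
dot-⊟ (a , b) (x , y) (z , w) = solve 6 (λ a b x y z w →
  a :* (z :- x) :+ b :* (w :- y) := (a :* z :+ b :* w) :- (a :* x :+ b :* y)) refl a b x y z w
  where open ℤ.+-*-Solver

rot-⊟ : ∀ p q → rot (q ⊟ p) ≡ rot q ⊟ rot p
rot-⊟ (x , y) (z , w) = cong (_, z ℤ.- x) (ℤ.neg-distrib-+ w (ℤ.- y))

open ℚ.+-*-Solver using (solve; _:=_; _:+_; _:*_; _:-_; :-_; con)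

-- Signs of reals

Pos : ℝ → Set
Pos x = 0ℝ < x

infix 4 _≐_
-- Termwise equality of the representing sequences. Polynomial identities hold in this strong sense,
-- so the ring solver over `ℚ` proves them, and `Pos` is transported with the same bound and index.
_≐_ : ℝ → ℝ → Set
x ≐ y = ∀ n → seq x n ≡ seq y n

Pos-resp-≐ : ∀ {x y} → x ≐ y → Pos x → Pos y
Pos-resp-≐ e (ε , 0<ε , N , h) = ε , 0<ε , N , λ n p → subst (0ℚ ℚ.+ ε ℚ.≤_) (e n) (h n p)

pos-intro : ∀ {x ε} N → 0ℚ ℚ.< ε → (∀ n → N ℕ.≤ n → ε ℚ.≤ seq x n) → Pos x
pos-intro {x} {ε} N 0<ε h = ε , 0<ε , N , λ n p → subst (ℚ._≤ seq x n) (sym (ℚ.+-identityˡ ε)) (h n p)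

pos-elim : ∀ {x} → Pos x → ∃[ ε ] (0ℚ ℚ.< ε × ∃[ N ] (∀ n → N ℕ.≤ n → ε ℚ.≤ seq x n))
pos-elim {x} (ε , 0<ε , N , h) = ε , 0<ε , N , λ n p → subst (ℚ._≤ seq x n) (ℚ.+-identityˡ ε) (h n p)

half+half : ∀ ε → ε ℚ.* ½ ℚ.+ ε ℚ.* ½ ≡ ε
half+half ε = trans (sym (ℚ.*-distribˡ-+ ε ½ ½)) (ℚ.*-identityʳ ε)

half-pos : ∀ {ε} → 0ℚ ℚ.< ε → 0ℚ ℚ.< ε ℚ.* ½
half-pos = ℚ.*-monoˡ-<-pos ½

≤∣∣ : ∀ p → p ℚ.≤ ∣ p ∣
≤∣∣ p with ℚ.≤-total 0ℚ p
... | inj₁ 0≤p = ℚ.≤-reflexive (sym (ℚ.0≤p⇒∣p∣≡p 0≤p))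
... | inj₂ p≤0 = ℚ.≤-trans p≤0 (ℚ.0≤∣p∣ p)

<+ : ∀ {p q δ} → ∣ p ℚ.- q ∣ ℚ.< δ → p ℚ.< q ℚ.+ δ
<+ {p} {q} {δ} h = begin-strict
  p                 ≡⟨ solve 2 (λ p q → p := q :+ (p :- q)) refl p q ⟩
  q ℚ.+ (p ℚ.- q)   <⟨ ℚ.+-monoʳ-< q (ℚ.≤-<-trans (≤∣∣ (p ℚ.- q)) h) ⟩
  q ℚ.+ δ           ∎
  where open ℚ.≤-Reasoning

-- A single late term of size `ε` is enough: all later terms stay within half of `ε` of it. This
-- turns a negated `Pos` into a bound on every late term.
peak : ∀ {x ε N n} → 0ℚ ℚ.< ε →
  (∀ i j → N ℕ.≤ i → N ℕ.≤ j → ∣ seq x i ℚ.- seq x j ∣ ℚ.< ε ℚ.* ½) →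
  N ℕ.≤ n → ε ℚ.≤ seq x n → Pos x
peak {x} {ε} {N} {n} 0<ε c N≤n ε≤xn = pos-intro {x} N (half-pos 0<ε) λ k N≤k →
  ℚ.≮⇒≥ λ xk<ε/2 → ℚ.<-irrefl refl (begin-strict
    ε                          ≤⟨ ε≤xn ⟩
    seq x n                    <⟨ <+ (c n k N≤n N≤k) ⟩
    seq x k ℚ.+ ε ℚ.* ½        <⟨ ℚ.+-monoˡ-< (ε ℚ.* ½) xk<ε/2 ⟩
    ε ℚ.* ½ ℚ.+ ε ℚ.* ½        ≡⟨ half+half ε ⟩
    ε                          ∎)
  where open ℚ.≤-Reasoning

-- If a late term of `x + y` were below `ε / 2` while that of `x` is at least `ε`, the term of `- y`
-- would be at least `ε / 2`, and `peak` would make `- y` positive.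
pos+nonneg⇒pos : ∀ x y → Pos x → ¬ Pos (- y) → Pos (x + y)
pos+nonneg⇒pos x y 0<x y≮0 =
  let ε , 0<ε , N , h = pos-elim {x} 0<x
      δ = ε ℚ.* ½
      M , c = cauchy (- y) (δ ℚ.* ½) (half-pos (half-pos 0<ε))
  in pos-intro {x + y} (N ⊔ M) (half-pos 0<ε) λ n p → ℚ.≮⇒≥ λ lt → y≮0
    (peak { - y} {δ} {M} {n} (half-pos 0<ε) c (ℕ.m⊔n≤o⇒n≤o N M p) (begin
      δ                                    ≡⟨ solve 2 (λ d e → d := (e :- d) :- (e :- (d :+ d))) refl δ ε ⟩
      (ε ℚ.- δ) ℚ.- (ε ℚ.- (δ ℚ.+ δ))      ≡⟨ cong (λ t → (ε ℚ.- δ) ℚ.- (ε ℚ.- t)) (half+half ε) ⟩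
      (ε ℚ.- δ) ℚ.- (ε ℚ.- ε)              ≡⟨ solve 2 (λ d e → (e :- d) :- (e :- e) := e :- d) refl δ ε ⟩
      ε ℚ.- δ                              ≤⟨ ℚ.+-mono-≤ (h n (ℕ.m⊔n≤o⇒m≤o N M p)) (ℚ.neg-antimono-≤ (ℚ.<⇒≤ lt)) ⟩
      seq x n ℚ.- (seq x n ℚ.+ seq y n)    ≡⟨ solve 2 (λ a b → a :- (a :+ b) := :- b) refl (seq x n) (seq y n) ⟩
      ℚ.- seq y n                          ∎))
  where open ℚ.≤-Reasoning

pos*pos⇒pos : ∀ x y → Pos x → Pos y → Pos (x * y)
pos*pos⇒pos x y 0<x 0<y =
  let ε , 0<ε , N , h = pos-elim {x} 0<x
      δ , 0<δ , M , g = pos-elim {y} 0<y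
      0<εδ = ℚ.positive⁻¹ (ε ℚ.* δ) {{ℚ.pos*pos⇒pos ε {{ℚ.positive 0<ε}} δ {{ℚ.positive 0<δ}}}}
  in pos-intro {x * y} (N ⊔ M) 0<εδ λ n p →
    ℚ.≤-trans (ℚ.*-monoʳ-≤-nonNeg δ {{ℚ.pos⇒nonNeg δ {{ℚ.positive 0<δ}}}} (h n (ℕ.m⊔n≤o⇒m≤o N M p)))
              (ℚ.*-monoˡ-≤-nonNeg (seq x n) {{ℚ.nonNegative (ℚ.≤-trans (ℚ.<⇒≤ 0<ε) (h n (ℕ.m⊔n≤o⇒m≤o N M p)))}}
                (g n (ℕ.m⊔n≤o⇒n≤o N M p)))

≈0⇒¬pos : ∀ x → x ≈ 0ℝ → ¬ Pos x
≈0⇒¬pos x x≈0 0<x =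
  let ε , 0<ε , N , h = pos-elim {x} 0<x
      M , g = x≈0 ε 0<ε
      n = N ⊔ M
  in ℚ.<-irrefl refl (ℚ.≤-<-trans (h n (ℕ.m≤m⊔n N M))
       (ℚ.≤-<-trans (≤∣∣ (seq x n))
         (subst (λ t → ∣ t ∣ ℚ.< ε) (solve 1 (λ a → a :- con 0ℚ := a) refl (seq x n)) (g n (ℕ.m≤n⊔m N M)))))

-- The order on `ℚ` is decidable, so each late term can be bounded by contradiction: if its absolute
-- value were at least `ε`, `peak` would make `x` or `- x` positive.
≈0-intro : ∀ x → ¬ Pos x → ¬ Pos (- x) → x ≈ 0ℝ
≈0-intro x x≯0 x≮0 ε 0<ε =
  let N , c = cauchy x (ε ℚ.* ½) (half-pos 0<ε)
      M , d = cauchy (- x) (ε ℚ.* ½) (half-pos 0<ε)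
  in N ⊔ M , λ n p → subst (λ t → ∣ t ∣ ℚ.< ε) (sym (solve 1 (λ a → a :- con 0ℚ := a) refl (seq x n)))
    (ℚ.≰⇒> λ ε≤∣xn∣ → case (ℚ.∣p∣≡p∨∣p∣≡-p (seq x n)) of λ
      { (inj₁ e) → x≯0 (peak {x} {ε} {N} {n} 0<ε c (ℕ.m⊔n≤o⇒m≤o N M p) (subst (ε ℚ.≤_) e ε≤∣xn∣))
      ; (inj₂ e) → x≮0 (peak { - x} {ε} {M} {n} 0<ε d (ℕ.m⊔n≤o⇒n≤o N M p) (subst (ε ℚ.≤_) e ε≤∣xn∣)) })

bounded : ∀ x → ∃[ B ] (0ℚ ℚ.< B × ∃[ N ] (∀ n → N ℕ.≤ n → ∣ seq x n ∣ ℚ.≤ B))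
bounded x =
  let N , c = cauchy x 1ℚ 0<1
  in ∣ seq x N ∣ ℚ.+ 1ℚ , ℚ.+-mono-≤-< (ℚ.0≤∣p∣ (seq x N)) 0<1 , N , λ n p → begin
    ∣ seq x n ∣
      ≡⟨ cong ∣_∣ (solve 2 (λ a b → a := b :+ (a :- b)) refl (seq x n) (seq x N)) ⟩
    ∣ seq x N ℚ.+ (seq x n ℚ.- seq x N) ∣
      ≤⟨ ℚ.∣p+q∣≤∣p∣+∣q∣ (seq x N) (seq x n ℚ.- seq x N) ⟩
    ∣ seq x N ∣ ℚ.+ ∣ seq x n ℚ.- seq x N ∣
      ≤⟨ ℚ.+-monoʳ-≤ ∣ seq x N ∣ (ℚ.<⇒≤ (c n N p ℕ.≤-refl)) ⟩
    ∣ seq x N ∣ ℚ.+ 1ℚ ∎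
  where
  open ℚ.≤-Reasoning
  0<1 : 0ℚ ℚ.< 1ℚ
  0<1 = ℚ.positive⁻¹ 1ℚ

divide : ∀ {B ε} → 0ℚ ℚ.< B → 0ℚ ℚ.< ε → ∃[ δ ] (0ℚ ℚ.< δ × δ ℚ.* B ≡ ε)
divide {B} {ε} 0<B 0<ε = ε ℚ.* ℚ.1/ B
  , ℚ.positive⁻¹ (ε ℚ.* ℚ.1/ B) {{ℚ.pos*pos⇒pos ε {{ℚ.positive 0<ε}} (ℚ.1/ B) {{ℚ.1/pos⇒pos B}}}}
  , trans (ℚ.*-assoc ε (ℚ.1/ B) B) (trans (cong (ε ℚ.*_) (ℚ.*-inverseˡ B)) (ℚ.*-identityʳ ε))
  where
  instance
    B-pos : ℚ.Positive B
    B-pos = ℚ.positive 0<B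
    B-nonZero : ℚ.NonZero B
    B-nonZero = ℚ.pos⇒nonZero B

∣p-0∣≡∣p∣ : ∀ p → ∣ p ℚ.- 0ℚ ∣ ≡ ∣ p ∣
∣p-0∣≡∣p∣ p = cong ∣_∣ (ℚ.+-identityʳ p)

≈0-*ʳ : ∀ x y → x ≈ 0ℝ → x * y ≈ 0ℝ
≈0-*ʳ x y x≈0 ε 0<ε =
  let B , 0<B , N , y≤B = bounded y
      δ , 0<δ , δB≡ε = divide 0<B 0<ε
      M , h = x≈0 δ 0<δ
  in M ⊔ N , λ n p → begin-strict
    ∣ seq x n ℚ.* seq y n ℚ.- 0ℚ ∣
      ≡⟨ ∣p-0∣≡∣p∣ (seq x n ℚ.* seq y n) ⟩
    ∣ seq x n ℚ.* seq y n ∣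
      ≡⟨ ℚ.∣p*q∣≡∣p∣*∣q∣ (seq x n) (seq y n) ⟩
    ∣ seq x n ∣ ℚ.* ∣ seq y n ∣
      ≤⟨ ℚ.*-monoˡ-≤-nonNeg ∣ seq x n ∣ {{ℚ.∣-∣-nonNeg (seq x n)}} (y≤B n (ℕ.m⊔n≤o⇒n≤o M N p)) ⟩
    ∣ seq x n ∣ ℚ.* B
      <⟨ ℚ.*-monoˡ-<-pos B {{ℚ.positive 0<B}} (subst (ℚ._< δ) (∣p-0∣≡∣p∣ (seq x n)) (h n (ℕ.m⊔n≤o⇒m≤o M N p))) ⟩
    δ ℚ.* B
      ≡⟨ δB≡ε ⟩
    ε ∎
  where open ℚ.≤-Reasoning

pos-asym : ∀ x → Pos x → ¬ Pos (- x)
pos-asym x 0<x x<0 =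
  let ε , 0<ε , N , h = pos-elim {x} 0<x
      δ , 0<δ , M , g = pos-elim { - x} x<0
      n = N ⊔ M
  in ℚ.<-irrefl (sym (ℚ.+-inverseʳ (seq x n)))
       (ℚ.+-mono-< {0ℚ} {seq x n} {0ℚ} {ℚ.- seq x n}
         (ℚ.<-≤-trans 0<ε (h n (ℕ.m≤m⊔n N M))) (ℚ.<-≤-trans 0<δ (g n (ℕ.m≤n⊔m N M))))

-- A `y` that is not positive cannot be negative either, since then `x * y` would be negative; so
-- `y ≈ 0ℝ`, and the product would vanish. The double negation is harmless because the final goal is
-- a refutation.
pos-cancelˡ : ∀ x y → Pos x → Pos (x * y) → ¬ ¬ Pos y
pos-cancelˡ x y 0<x 0<xy y≯0 = ≈0⇒¬pos (y * x) (≈0-*ʳ y x (≈0-intro y y≯0 y≮0))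
  (Pos-resp-≐ {x * y} {y * x} (λ n → ℚ.*-comm (seq x n) (seq y n)) 0<xy)
  where
  y≮0 : ¬ Pos (- y)
  y≮0 0<-y = pos-asym (x * y) 0<xy
    (Pos-resp-≐ {x * (- y)} { - (x * y)} (λ n → sym (ℚ.neg-distribʳ-* (seq x n) (seq y n)))
      (pos*pos⇒pos x (- y) 0<x 0<-y))

-- The fractions are normalised by a gcd, so the identity is checked among unnormalised rationals.
/1-homo-+ : ∀ i j → (i ℤ.+ j) ℚ./ 1 ≡ i ℚ./ 1 ℚ.+ j ℚ./ 1
/1-homo-+ i j = ℚ.toℚᵘ-injective (begin
  ℚ.toℚᵘ ((i ℤ.+ j) ℚ./ 1)                   ≈⟨ ℚ.toℚᵘ-fromℚᵘ (ℚᵘ.mkℚᵘ (i ℤ.+ j) 0) ⟩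
  ℚᵘ.mkℚᵘ (i ℤ.+ j) 0                        ≈⟨ ℚᵘ.*≡* (cong (ℤ._* (+ 1)) (sym (cong₂ ℤ._+_ (ℤ.*-identityʳ i) (ℤ.*-identityʳ j)))) ⟩
  ℚᵘ.mkℚᵘ i 0 ℚᵘ.+ ℚᵘ.mkℚᵘ j 0               ≈⟨ ℚᵘ.+-cong (ℚ.toℚᵘ-fromℚᵘ (ℚᵘ.mkℚᵘ i 0)) (ℚ.toℚᵘ-fromℚᵘ (ℚᵘ.mkℚᵘ j 0)) ⟨
  ℚ.toℚᵘ (i ℚ./ 1) ℚᵘ.+ ℚ.toℚᵘ (j ℚ./ 1)     ≈⟨ ℚ.toℚᵘ-homo-+ (i ℚ./ 1) (j ℚ./ 1) ⟨
  ℚ.toℚᵘ (i ℚ./ 1 ℚ.+ j ℚ./ 1)               ∎)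
  where open ℚᵘ.≃-Reasoning

/1-homo-* : ∀ i j → (i ℤ.* j) ℚ./ 1 ≡ (i ℚ./ 1) ℚ.* (j ℚ./ 1)
/1-homo-* i j = ℚ.toℚᵘ-injective (begin
  ℚ.toℚᵘ ((i ℤ.* j) ℚ./ 1)                   ≈⟨ ℚ.toℚᵘ-fromℚᵘ (ℚᵘ.mkℚᵘ (i ℤ.* j) 0) ⟩
  ℚᵘ.mkℚᵘ i 0 ℚᵘ.* ℚᵘ.mkℚᵘ j 0               ≈⟨ ℚᵘ.*-cong (ℚ.toℚᵘ-fromℚᵘ (ℚᵘ.mkℚᵘ i 0)) (ℚ.toℚᵘ-fromℚᵘ (ℚᵘ.mkℚᵘ j 0)) ⟨
  ℚ.toℚᵘ (i ℚ./ 1) ℚᵘ.* ℚ.toℚᵘ (j ℚ./ 1)     ≈⟨ ℚ.toℚᵘ-homo-* (i ℚ./ 1) (j ℚ./ 1) ⟨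
  ℚ.toℚᵘ ((i ℚ./ 1) ℚ.* (j ℚ./ 1))           ∎)
  where open ℚᵘ.≃-Reasoning

/1-homo‿- : ∀ i → (ℤ.- i) ℚ./ 1 ≡ ℚ.- (i ℚ./ 1)
/1-homo‿- i = ℚ.toℚᵘ-injective (begin
  ℚ.toℚᵘ ((ℤ.- i) ℚ./ 1)                   ≈⟨ ℚ.toℚᵘ-fromℚᵘ (ℚᵘ.mkℚᵘ (ℤ.- i) 0) ⟩
  ℚᵘ.- ℚᵘ.mkℚᵘ i 0                         ≈⟨ ℚᵘ.-‿cong (ℚ.toℚᵘ-fromℚᵘ (ℚᵘ.mkℚᵘ i 0)) ⟨
  ℚᵘ.- ℚ.toℚᵘ (i ℚ./ 1)                    ≈⟨ ℚ.toℚᵘ-homo‿- (i ℚ./ 1) ⟨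
  ℚ.toℚᵘ (ℚ.- (i ℚ./ 1))                   ∎)
  where open ℚᵘ.≃-Reasoning

fromℤ-pos : ∀ {i} → 0ℤ ℤ.< i → Pos (fromℤ i)
fromℤ-pos {+ suc k} _ = pos-intro {fromℤ (+ suc k)} 0
  (ℚ.positive⁻¹ (+ suc k ℚ./ 1) {{ℚ.normalize-pos (suc k) 1}}) λ _ _ → ℚ.≤-refl
fromℤ-pos {ℤ.+0} (ℤ.+<+ ())

≈0-neg : ∀ x → x ≈ 0ℝ → - x ≈ 0ℝ
≈0-neg x x≈0 ε 0<ε = proj₁ (x≈0 ε 0<ε) , λ n p →
  subst (ℚ._< ε) (trans (∣p-0∣≡∣p∣ (seq x n)) (trans (sym (ℚ.∣-p∣≡∣p∣ (seq x n))) (sym (∣p-0∣≡∣p∣ (ℚ.- seq x n)))))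
    (proj₂ (x≈0 ε 0<ε) n p)

≈0-resp-≐ : ∀ {x y} → x ≐ y → x ≈ 0ℝ → y ≈ 0ℝ
≈0-resp-≐ e x≈0 ε 0<ε = proj₁ (x≈0 ε 0<ε) , λ n p →
  subst (λ t → ∣ t ℚ.- 0ℚ ∣ ℚ.< ε) (e n) (proj₂ (x≈0 ε 0<ε) n p)

-‿involutive : ∀ x → - (- x) ≐ x
-‿involutive x n = solve 1 (λ a → :- (:- a) := a) refl (seq x n)

≯0-+ : ∀ x y → ¬ Pos x → ¬ Pos y → ¬ Pos (x + y)
≯0-+ x y x≯0 y≯0 0<x+y = x≯0 (Pos-resp-≐ {(x + y) + (- y)} {x}
  (λ n → solve 2 (λ a b → (a :+ b) :+ (:- b) := a) refl (seq x n) (seq y n))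
  (pos+nonneg⇒pos (x + y) (- y) 0<x+y λ 0<--y → y≯0 (Pos-resp-≐ { - (- y)} {y} (-‿involutive y) 0<--y)))

≈0-+ : ∀ x y → x ≈ 0ℝ → y ≈ 0ℝ → x + y ≈ 0ℝ
≈0-+ x y x≈0 y≈0 = ≈0-intro (x + y)
  (≯0-+ x y (≈0⇒¬pos x x≈0) (≈0⇒¬pos y y≈0))
  λ neg → ≯0-+ (- x) (- y) (≈0⇒¬pos (- x) (≈0-neg x x≈0)) (≈0⇒¬pos (- y) (≈0-neg y y≈0))
    (Pos-resp-≐ { - (x + y)} {(- x) + (- y)} (λ n → solve 2 (λ a b → :- (a :+ b) := :- a :+ :- b) refl (seq x n) (seq y n)) neg)

square-pos : ∀ x → Pos (- x) → Pos (x * x)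
square-pos x x<0 = Pos-resp-≐ {(- x) * (- x)} {x * x}
  (λ n → solve 1 (λ a → :- a :* :- a := a :* a) refl (seq x n)) (pos*pos⇒pos (- x) (- x) x<0 x<0)

square≮0 : ∀ x → ¬ Pos (- (x * x))
square≮0 x neg = ≈0⇒¬pos (- (x * x)) (≈0-neg (x * x) (≈0-*ʳ x x (≈0-intro x
  (λ 0<x → pos-asym (x * x) (pos*pos⇒pos x x 0<x 0<x) neg)
  (λ x<0 → pos-asym (x * x) (square-pos x x<0) neg)))) neg

-- Affine functionals

ι : ℤ → ℚ
ι i = i ℚ./ 1

-- A line together with the choice of a positive side.
record Affine : Set where
  constructor affine
  field
    a b c : ℝ

  infix 7 ∙_
  ∙_ : ℤ² → ℝ
  ∙ (x , y) = a * fromℤ x + b * fromℤ y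

  ⟦_⟧ : ℤ² → ℝ
  ⟦ p ⟧ = ∙ p - c

  norm² : ℝ
  norm² = a * a + b * b

open Affine using (⟦_⟧; norm²)

infix 7 _∙_
_∙_ : Affine → ℤ² → ℝ
_∙_ = Affine.∙_

flip : Affine → Affine
flip (affine a b c) = affine (- a) (- b) (- c)

-- Inner product and determinant of the two normals; `e ⊗ d` is positive when `e` points to the
-- clockwise side of `d`.
_⊙_ _⊗_ : Affine → Affine → ℝ
affine a b _ ⊙ affine a′ b′ _ = a * a′ + b * b′
affine a b _ ⊗ affine a′ b′ _ = a * b′ - b * a′

≐-unrot : ∀ d v → - (d ∙ unrot v) ≐ d ∙ rot v
≐-unrot (affine a b _) (x , y) n rewrite /1-homo‿- x | /1-homo‿- y =
  solve 4 (λ a b x y → :- (a :* y :+ b :* :- x) := a :* :- y :+ b :* x) refl (seq a n) (seq b n) (ι x) (ι y)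

≐-difference : ∀ d p q → ⟦ d ⟧ q ≐ d ∙ (q ⊟ p) + ⟦ d ⟧ p
≐-difference (affine a b c) (x , y) (z , w) n
  rewrite /1-homo-+ z (ℤ.- x) | /1-homo-+ w (ℤ.- y) | /1-homo‿- x | /1-homo‿- y =
  solve 7 (λ a b c x y z w → (a :* z :+ b :* w) :+ :- c :=
      (a :* (z :+ :- x) :+ b :* (w :+ :- y)) :+ ((a :* x :+ b :* y) :+ :- c)) refl
    (seq a n) (seq b n) (seq c n) (ι x) (ι y) (ι z) (ι w)

ι-dot : ∀ v w → ι (dot v w) ≡ ι (proj₁ v) ℚ.* ι (proj₁ w) ℚ.+ ι (proj₂ v) ℚ.* ι (proj₂ w)
ι-dot (x , y) (z , w) = trans (/1-homo-+ (x ℤ.* z) (y ℤ.* w)) (cong₂ ℚ._+_ (/1-homo-* x z) (/1-homo-* y w))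

ι-cross : ∀ v w → ι (cross v w) ≡ ι (proj₁ v) ℚ.* ι (proj₂ w) ℚ.- ι (proj₂ v) ℚ.* ι (proj₁ w)
ι-cross (x , y) (z , w) = trans (/1-homo-+ (x ℤ.* w) (ℤ.- (y ℤ.* z)))
  (cong₂ ℚ._+_ (/1-homo-* x w) (trans (/1-homo‿- (y ℤ.* z)) (cong ℚ.-_ (/1-homo-* y z))))

-- Cramer's rule: up to the factor `cross g h`, the normal of `d` has the coordinates `d ∙ unrot h`
-- and `d ∙ rot g` in the basis `g`, `h`. Here it is paired with `v`, and in `cramer-norm²` with
-- itself.
cramer-∙ : ∀ d g h v →
  fromℤ (cross g h) * (d ∙ v) ≐ (d ∙ unrot h) * fromℤ (dot g v) + (d ∙ rot g) * fromℤ (dot h v)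
cramer-∙ (affine a b _) g@(g₁ , g₂) h@(h₁ , h₂) v@(x , y) n
  rewrite ι-cross g h | ι-dot g v | ι-dot h v | /1-homo‿- h₁ | /1-homo‿- g₂ =
  solve 8 (λ a b g₁ g₂ h₁ h₂ x y →
      (g₁ :* h₂ :- g₂ :* h₁) :* (a :* x :+ b :* y) :=
      (a :* h₂ :+ b :* :- h₁) :* (g₁ :* x :+ g₂ :* y) :+ (a :* :- g₂ :+ b :* g₁) :* (h₁ :* x :+ h₂ :* y)) refl
    (seq a n) (seq b n) (ι g₁) (ι g₂) (ι h₁) (ι h₂) (ι x) (ι y)

cramer-norm² : ∀ d g h →
  fromℤ (cross g h) * norm² d ≐ (d ∙ unrot h) * (d ∙ g) + (d ∙ rot g) * (d ∙ h)
cramer-norm² (affine a b _) g@(g₁ , g₂) h@(h₁ , h₂) n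
  rewrite ι-cross g h | /1-homo‿- h₁ | /1-homo‿- g₂ =
  solve 6 (λ a b g₁ g₂ h₁ h₂ →
      (g₁ :* h₂ :- g₂ :* h₁) :* (a :* a :+ b :* b) :=
      (a :* h₂ :+ b :* :- h₁) :* (a :* g₁ :+ b :* g₂) :+ (a :* :- g₂ :+ b :* g₁) :* (a :* h₁ :+ b :* h₂)) refl
    (seq a n) (seq b n) (ι g₁) (ι g₂) (ι h₁) (ι h₂)

-- Expansion of the normal of `e` in the orthogonal basis formed by the normal of `d` and its
-- clockwise quarter turn.
norm²-∙ : ∀ d e v → norm² d * (e ∙ v) ≐ (e ⊗ d) * (d ∙ rot v) + (d ⊙ e) * (d ∙ v)
norm²-∙ (affine a b _) (affine a′ b′ _) (x , y) n rewrite /1-homo‿- y =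
  solve 6 (λ a b a′ b′ x y →
      (a :* a :+ b :* b) :* (a′ :* x :+ b′ :* y) :=
      (a′ :* b :- b′ :* a) :* (a :* :- y :+ b :* x) :+ (a :* a′ :+ b :* b′) :* (a :* x :+ b :* y)) refl
    (seq a n) (seq b n) (seq a′ n) (seq b′ n) (ι x) (ι y)

-- Lagrange's identity.
norm²-norm² : ∀ d e → norm² d * norm² e ≐ (e ⊗ d) * (e ⊗ d) + (d ⊙ e) * (d ⊙ e)
norm²-norm² (affine a b _) (affine a′ b′ _) n =
  solve 4 (λ a b a′ b′ →
      (a :* a :+ b :* b) :* (a′ :* a′ :+ b′ :* b′) :=
      (a′ :* b :- b′ :* a) :* (a′ :* b :- b′ :* a) :+ (a :* a′ :+ b :* b′) :* (a :* a′ :+ b :* b′)) refl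
    (seq a n) (seq b n) (seq a′ n) (seq b′ n)

toAffine : Line → Affine
toAffine ℓ = affine (Line.a ℓ) (Line.b ℓ) (Line.c ℓ)

norm²-pos : ∀ ℓ → ¬ ¬ Pos (norm² (toAffine ℓ))
norm²-pos ℓ n≯0 = nondegenerate
  ( ≈0-intro a (λ 0<a → a²≯0 (pos*pos⇒pos a a 0<a 0<a)) (λ a<0 → a²≯0 (square-pos a a<0))
  , ≈0-intro b (λ 0<b → b²≯0 (pos*pos⇒pos b b 0<b 0<b)) (λ b<0 → b²≯0 (square-pos b b<0)) )
  where
  open Line ℓ
  a²≯0 : ¬ Pos (a * a)
  a²≯0 0<a² = n≯0 (pos+nonneg⇒pos (a * a) (b * b) 0<a² (square≮0 b))
  b²≯0 : ¬ Pos (b * b)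
  b²≯0 0<b² = n≯0 (Pos-resp-≐ {b * b + a * a} {a * a + b * b} (λ n → ℚ.+-comm (seq (b * b) n) (seq (a * a) n))
    (pos+nonneg⇒pos (b * b) (a * a) 0<b² (square≮0 a)))

-- For cross g h > 0: the normal of d lies in the closed convex cone spanned by g and h.
InCone : ℤ² → ℤ² → Affine → Set
InCone g h d = ¬ Pos (- (d ∙ rot g)) × ¬ Pos (- (d ∙ unrot h))

-- Both Cramer coordinates of `d` are nonnegative. If `d ∙ v` were not positive, `cramer-∙` would
-- forbid either of them to be positive; both would vanish, and by `cramer-norm²` so would the
-- normal of `d`.
cone-pos : ∀ g h d v → Pos (norm² d) → 0ℤ ℤ.< cross g h → InCone g h d →
  0ℤ ℤ.< dot g v → 0ℤ ℤ.< dot h v → ¬ ¬ Pos (d ∙ v)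
cone-pos g h d v 0<d 0<gh (β≮0 , α≮0) 0<gv 0<hv dv≯0 = ≈0⇒¬pos (α * (d ∙ g) + β * (d ∙ h))
    (≈0-+ (α * (d ∙ g)) (β * (d ∙ h))
      (≈0-*ʳ α (d ∙ g) (≈0-intro α α≯0 α≮0)) (≈0-*ʳ β (d ∙ h) (≈0-intro β β≯0 β≮0)))
    (Pos-resp-≐ {fromℤ (cross g h) * norm² d} {α * (d ∙ g) + β * (d ∙ h)} (cramer-norm² d g h)
      (pos*pos⇒pos (fromℤ (cross g h)) (norm² d) (fromℤ-pos 0<gh) 0<d))
  where
  α = d ∙ unrot h
  β = d ∙ rot g
  scale≮0 : ∀ x {i} → 0ℤ ℤ.< i → ¬ Pos (- x) → ¬ Pos (- (x * fromℤ i))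
  scale≮0 x {i} 0<i x≮0 neg = pos-cancelˡ (fromℤ i) (- x) (fromℤ-pos 0<i)
    (Pos-resp-≐ { - (x * fromℤ i)} {fromℤ i * (- x)}
      (λ n → solve 2 (λ x i → :- (x :* i) := i :* :- x) refl (seq x n) (ι i)) neg) x≮0
  sum≯0 : ¬ Pos (α * fromℤ (dot g v) + β * fromℤ (dot h v))
  sum≯0 0<sum = pos-cancelˡ (fromℤ (cross g h)) (d ∙ v) (fromℤ-pos 0<gh)
    (Pos-resp-≐ {α * fromℤ (dot g v) + β * fromℤ (dot h v)} {fromℤ (cross g h) * (d ∙ v)}
      (λ n → sym (cramer-∙ d g h v n)) 0<sum) dv≯0
  α≯0 : ¬ Pos α
  α≯0 0<α = sum≯0 (pos+nonneg⇒pos (α * fromℤ (dot g v)) (β * fromℤ (dot h v))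
    (pos*pos⇒pos α (fromℤ (dot g v)) 0<α (fromℤ-pos 0<gv)) (scale≮0 β 0<hv β≮0))
  β≯0 : ¬ Pos β
  β≯0 0<β = sum≯0 (Pos-resp-≐ {β * fromℤ (dot h v) + α * fromℤ (dot g v)} {α * fromℤ (dot g v) + β * fromℤ (dot h v)}
    (λ n → ℚ.+-comm (seq (β * fromℤ (dot h v)) n) (seq (α * fromℤ (dot g v)) n))
    (pos+nonneg⇒pos (β * fromℤ (dot h v)) (α * fromℤ (dot g v))
      (pos*pos⇒pos β (fromℤ (dot h v)) 0<β (fromℤ-pos 0<hv)) (scale≮0 α 0<gv α≮0)))

perpendicular-pos : ∀ d e v → Pos (norm² d) → d ⊙ e ≈ 0ℝ → Pos (e ⊗ d) →
  Pos (d ∙ rot v) → ¬ ¬ Pos (e ∙ v)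
perpendicular-pos d e v 0<d d⊥e 0<ed 0<dv = pos-cancelˡ (norm² d) (e ∙ v) 0<d
  (Pos-resp-≐ {(e ⊗ d) * (d ∙ rot v) + (d ⊙ e) * (d ∙ v)} {norm² d * (e ∙ v)}
    (λ n → sym (norm²-∙ d e v n))
    (pos+nonneg⇒pos ((e ⊗ d) * (d ∙ rot v)) ((d ⊙ e) * (d ∙ v))
      (pos*pos⇒pos (e ⊗ d) (d ∙ rot v) 0<ed 0<dv)
      (≈0⇒¬pos (- ((d ⊙ e) * (d ∙ v))) (≈0-neg ((d ⊙ e) * (d ∙ v)) (≈0-*ʳ (d ⊙ e) (d ∙ v) d⊥e)))))

-- If `e ⊗ d` vanished as well, the right side of Lagrange's identity would be zero and the left
-- side positive. This gives the two possible orientations of a perpendicular pair.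
perpendicular-oriented : ∀ d e → Pos (norm² d) → Pos (norm² e) → d ⊙ e ≈ 0ℝ →
  ¬ Pos (e ⊗ d) → ¬ ¬ Pos (- (e ⊗ d))
perpendicular-oriented d e 0<d 0<e d⊥e ed≯0 ed≮0 = ≈0⇒¬pos ((e ⊗ d) * (e ⊗ d) + (d ⊙ e) * (d ⊙ e))
  (≈0-+ ((e ⊗ d) * (e ⊗ d)) ((d ⊙ e) * (d ⊙ e))
    (≈0-*ʳ (e ⊗ d) (e ⊗ d) (≈0-intro (e ⊗ d) ed≯0 ed≮0)) (≈0-*ʳ (d ⊙ e) (d ⊙ e) d⊥e))
  (Pos-resp-≐ {norm² d * norm² e} {(e ⊗ d) * (e ⊗ d) + (d ⊙ e) * (d ⊙ e)} (norm²-norm² d e)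
    (pos*pos⇒pos (norm² d) (norm² e) 0<d 0<e))

on-difference : ∀ ℓ p q → p liesOn ℓ → q liesOn ℓ → toAffine ℓ ∙ (q ⊟ p) ≈ 0ℝ
on-difference ℓ p q p∈ℓ q∈ℓ = ≈0-resp-≐ {⟦ d ⟧ q + - ⟦ d ⟧ p} {d ∙ (q ⊟ p)}
  (λ n → trans (cong (ℚ._- seq (⟦ d ⟧ p) n) (≐-difference d p q n))
    (solve 2 (λ x y → (x :+ y) :+ :- y := x) refl (seq (d ∙ (q ⊟ p)) n) (seq (⟦ d ⟧ p) n)))
  (≈0-+ (⟦ d ⟧ q) (- ⟦ d ⟧ p) q∈ℓ (≈0-neg (⟦ d ⟧ p) p∈ℓ))
  where
  d = toAffine ℓ

-- A normal orthogonal to two vectors that span the plane is zero, by `cramer-norm²`.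
cross>0⇒¬collinear : ∀ ℓ v w → 0ℤ ℤ.< cross v w → toAffine ℓ ∙ v ≈ 0ℝ → ¬ (toAffine ℓ ∙ w ≈ 0ℝ)
cross>0⇒¬collinear ℓ v w 0<vw dv≈0 dw≈0 = norm²-pos ℓ λ 0<d → ≈0⇒¬pos ((d ∙ v) * (d ∙ unrot w) + (d ∙ w) * (d ∙ rot v))
  (≈0-+ ((d ∙ v) * (d ∙ unrot w)) ((d ∙ w) * (d ∙ rot v))
    (≈0-*ʳ (d ∙ v) (d ∙ unrot w) dv≈0) (≈0-*ʳ (d ∙ w) (d ∙ rot v) dw≈0))
  (Pos-resp-≐ {fromℤ (cross v w) * norm² d} {(d ∙ v) * (d ∙ unrot w) + (d ∙ w) * (d ∙ rot v)}
    (λ n → trans (cramer-norm² d v w n) (cong₂ ℚ._+_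
      (ℚ.*-comm (seq (d ∙ unrot w) n) (seq (d ∙ v) n)) (ℚ.*-comm (seq (d ∙ rot v) n) (seq (d ∙ w) n))))
    (pos*pos⇒pos (fromℤ (cross v w)) (norm² d) (fromℤ-pos 0<vw) 0<d))
  where
  d = toAffine ℓ

Collinear : ℤ² → ℤ² → ℤ² → Set
Collinear p q r = ∃[ ℓ ] (p liesOn ℓ × q liesOn ℓ × r liesOn ℓ)

cross≢0⇒¬collinear : ∀ p q r → cross (q ⊟ p) (r ⊟ p) ≢ 0ℤ → ¬ Collinear p q r
cross≢0⇒¬collinear p q r c≢0 (ℓ , p∈ℓ , q∈ℓ , r∈ℓ) with ℤ.<-cmp 0ℤ (cross (q ⊟ p) (r ⊟ p))
... | tri< 0<c _ _ = cross>0⇒¬collinear ℓ (q ⊟ p) (r ⊟ p) 0<c (on-difference ℓ p q p∈ℓ q∈ℓ) (on-difference ℓ p r p∈ℓ r∈ℓ)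
... | tri≈ _ 0≡c _ = c≢0 (sym 0≡c)
... | tri> _ _ c<0 = cross>0⇒¬collinear ℓ (r ⊟ p) (q ⊟ p)
  (subst (0ℤ ℤ.<_) (cross-antisym (q ⊟ p) (r ⊟ p)) (ℤ.neg-mono-< c<0))
  (on-difference ℓ p r p∈ℓ r∈ℓ) (on-difference ℓ p q p∈ℓ q∈ℓ)

-- Points on the line itself may be on either side.
Separates : Affine → (ℤ² → Set) → ℤ² → Set
Separates d U p = (U p → ¬ Pos (- ⟦ d ⟧ p)) × (¬ U p → ¬ Pos (⟦ d ⟧ p))

-- The value at `q` is the nonnegative value at `p` plus a positive amount, so `q` is strictly on
-- the positive side. Decidability of `U q` removes the double negation.
separates-mono : ∀ (U : ℤ² → Set) d p q → Dec (U q) → Separates d U p → Separates d U q →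
  ¬ ¬ Pos (d ∙ (q ⊟ p)) → U p → U q
separates-mono U d p q U? sp sq 0<d[q-p] up = decidable-stable U? λ ¬uq → 0<d[q-p] λ pos →
  proj₂ sq ¬uq (Pos-resp-≐ {d ∙ (q ⊟ p) + ⟦ d ⟧ p} {⟦ d ⟧ q} (λ n → sym (≐-difference d p q n))
    (pos+nonneg⇒pos (d ∙ (q ⊟ p)) (⟦ d ⟧ p) pos (proj₁ sp up)))

-- Counting

private
  variable
    A B : Set

count : {P : Pred A 0ℓ} → Decidable P → List A → ℕ
count P? xs = length (filter P? xs)

module _ {P Q : Pred A 0ℓ} (P? : Decidable P) (Q? : Decidable Q) where

  count-mono : ∀ xs → (∀ {x} → x ∈ xs → P x → Q x) → count P? xs ℕ.≤ count Q? xs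
  count-mono []       _   = z≤n
  count-mono (x ∷ xs) P⇒Q with P? x | Q? x | count-mono xs (P⇒Q ∘ there)
  ... | yes _ | yes _ | ih = s≤s ih
  ... | yes p | no ¬q | _  = contradiction (P⇒Q (here refl) p) ¬q
  ... | no _  | yes _ | ih = ℕ.m≤n⇒m≤1+n ih
  ... | no _  | no _  | ih = ih

  count-mono-< : ∀ xs {y} → (∀ {x} → x ∈ xs → P x → Q x) → y ∈ xs → ¬ P y → Q y →
    count P? xs ℕ.< count Q? xs
  count-mono-< (x ∷ xs) P⇒Q (here refl) ¬p q with P? x | Q? x
  ... | yes p | _     = contradiction p ¬p
  ... | no _  | yes _ = s≤s (count-mono xs (P⇒Q ∘ there))
  ... | no _  | no ¬q = contradiction q ¬q
  count-mono-< (x ∷ xs) P⇒Q (there y∈xs) ¬p q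
    with P? x | Q? x | count-mono-< xs (P⇒Q ∘ there) y∈xs ¬p q
  ... | yes _ | yes _ | ih = s≤s ih
  ... | yes p | no ¬q | _  = contradiction (P⇒Q (here refl) p) ¬q
  ... | no _  | yes _ | ih = ℕ.m≤n⇒m≤1+n ih
  ... | no _  | no _  | ih = ih

  count-⊎ : (∀ {x} → P x → ¬ Q x) → ∀ xs →
    count (λ x → P? x ⊎-dec Q? x) xs ≡ count P? xs ℕ.+ count Q? xs
  count-⊎ disjoint []       = refl
  count-⊎ disjoint (x ∷ xs) with P? x | Q? x | count-⊎ disjoint xs
  ... | yes p | yes q | _  = contradiction q (disjoint p)
  ... | yes _ | no _  | ih = cong suc ih
  ... | no _  | yes _ | ih = trans (cong suc ih) (sym (ℕ.+-suc _ _))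
  ... | no _  | no _  | ih = ih

count-map : {P : Pred B 0ℓ} (P? : Decidable P) (f : A → B) → ∀ xs →
  count P? (map f xs) ≡ count (P? ∘ f) xs
count-map P? f []       = refl
count-map P? f (x ∷ xs) with P? (f x)
... | yes _ = cong suc (count-map P? f xs)
... | no _  = count-map P? f xs

-- Ranks of points over a cone of directions

Above : ℤ² → ℤ² → ℤ² → ℤ² → Set
Above g h p q = dot g p ℤ.< dot g q × dot h p ℤ.< dot h q

above? : ∀ g h p → Decidable (Above g h p)
above? g h p q = (dot g p ℤ.<? dot g q) ×-dec (dot h p ℤ.<? dot h q)

above-rot : ∀ g h p q → Above g h p q → Above (rot g) (rot h) (rot p) (rot q)
above-rot g h p q (l , m) = lift g l , lift h m
  where
  lift : ∀ g → dot g p ℤ.< dot g q → dot (rot g) (rot p) ℤ.< dot (rot g) (rot q)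
  lift g = subst₂ ℤ._<_ (sym (dot-rot g p)) (sym (dot-rot g q))

dot-<-⊟ : ∀ g p q → dot g p ℤ.< dot g q → 0ℤ ℤ.< dot g (q ⊟ p)
dot-<-⊟ g p q l = subst₂ ℤ._<_ (ℤ.+-inverseʳ (dot g p)) (sym (dot-⊟ g p q)) (ℤ.+-monoˡ-< (ℤ.- dot g p) l)

module _ (P : List ℤ²) (m k : ℕ) where

  -- Lower bounds, for every d in the cone of g and h, on the number of points beyond p in direction d
  -- and in the direction obtained from d by a clockwise quarter turn.
  topRank rightRank : ℤ² → ℤ² → ℤ² → ℕ
  topRank   g h p = count (above? g h p) P
  rightRank g h p = count (above? g h (rot p) ∘ rot) P

  MaybeTopRight : ℤ² → ℤ² → ℤ² → Set
  MaybeTopRight g h p = topRank g h p ℕ.< k ℕ.+ k × rightRank g h p ℕ.< m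

  maybeTopRight? : ∀ g h → Decidable (MaybeTopRight g h)
  maybeTopRight? g h p = (topRank g h p ℕ.<? k ℕ.+ k) ×-dec (rightRank g h p ℕ.<? m)

  record Unbalanced (g h : ℤ²) : Set where
    constructor unbalanced
    field
      oriented : 0ℤ ℤ.< cross g h
      few      : count (maybeTopRight? g h) P ℕ.< k

  unbalanced? : ∀ g h → Dec (Unbalanced g h)
  unbalanced? g h = map′ (λ (o , f) → unbalanced o f) (λ (unbalanced o f) → o , f)
    ((0ℤ ℤ.<? cross g h) ×-dec (count (maybeTopRight? g h) P ℕ.<? k))

  module _ (rot-P : map rot P ↭ P) where

    count-rot : {Q : Pred ℤ² 0ℓ} (Q? : Decidable Q) → count Q? P ≡ count (Q? ∘ rot) P
    count-rot Q? = trans (sym (↭-length (filter-↭ Q? rot-P))) (count-map Q? rot P)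

    -- Turning preserves `Above`, and counts over the invariant set `P` may be taken over turned
    -- points. So ranks do not decrease when point and cone are turned together, and every survivor
    -- for the turned cone is a turned survivor for the original one.
    unbalanced-rot : ∀ {g h} → Unbalanced g h → Unbalanced (rot g) (rot h)
    unbalanced-rot {g} {h} (unbalanced 0<gh few) = unbalanced (subst (0ℤ ℤ.<_) (sym (cross-rot g h)) 0<gh)
      (ℕ.≤-<-trans (ℕ.≤-trans (ℕ.≤-reflexive (count-rot (maybeTopRight? (rot g) (rot h))))
        (count-mono (maybeTopRight? (rot g) (rot h) ∘ rot) (maybeTopRight? g h) P λ {p} _ (t , r) →
          ℕ.≤-<-trans (top≤ p) t , ℕ.≤-<-trans (right≤ p) r)) few)
      where
      top≤ : ∀ p → topRank g h p ℕ.≤ topRank (rot g) (rot h) (rot p)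
      top≤ p = ℕ.≤-trans (count-mono (above? g h p) (above? (rot g) (rot h) (rot p) ∘ rot) P λ {q} _ → above-rot g h p q)
        (ℕ.≤-reflexive (sym (count-rot (above? (rot g) (rot h) (rot p)))))
      right≤ : ∀ p → rightRank g h p ℕ.≤ rightRank (rot g) (rot h) (rot p)
      right≤ p = ℕ.≤-trans (count-mono (above? g h (rot p) ∘ rot) (above? (rot g) (rot h) (rot (rot p)) ∘ rot ∘ rot) P
          λ {q} _ → above-rot g h (rot p) (rot q))
        (ℕ.≤-reflexive (sym (count-rot (above? (rot g) (rot h) (rot (rot p)) ∘ rot))))

    fan-rot : ∀ {g h} → TransClosure Unbalanced g h → TransClosure Unbalanced (rot g) (rot h)
    fan-rot [ c ]    = [ unbalanced-rot c ]
    fan-rot (c ∷ cs) = unbalanced-rot c ∷ fan-rot cs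

  -- Consecutive cones share a ray `h`. If `d` is not on the clockwise side of `h`, it satisfies the
  -- first condition for the remaining cones, and the induction applies to them.
  outside-fan : ∀ d → (∀ g h → Unbalanced g h → ¬ InCone g h d) →
    ∀ {g h} → TransClosure Unbalanced g h → ¬ InCone g h d
  outside-fan d outside {g} {h} [ c ] in-cone = outside g h c in-cone
  outside-fan d outside {g} (_∷_ {y = h} c cs) (l , r) = outside g h c (l , λ h<d →
    outside-fan d outside cs
      ( pos-asym (d ∙ rot h) (Pos-resp-≐ { - (d ∙ unrot h)} {d ∙ rot h} (≐-unrot d h) h<d) , r ))

  module _
    {Top Right Both : Pred ℤ² 0ℓ} (top? : Decidable Top) (right? : Decidable Right) (both? : Decidable Both)
    (both⇒top : ∀ {p} → Both p → Top p) (both⇒right : ∀ {p} → Both p → Right p)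
    (#top : count top? P ≡ k ℕ.+ k) (#right : count right? P ≡ m) (#both : count both? P ≡ k)
    (d e : Affine) (0<d : Pos (norm² d)) (d⊥e : d ⊙ e ≈ 0ℝ) (0<ed : Pos (e ⊗ d))
    (sep-top : ∀ {p} → p ∈ P → Separates d Top p) (sep-right : ∀ {p} → p ∈ P → Separates e Right p)
    where

    -- All `k` points of `Both` pass both rank tests, while fewer than `k` points of `P` do. The
    -- three predicates are kept abstract because the orientation of the lines decides which small
    -- class is `Both`.
    outside-unbalanced : ∀ g h → Unbalanced g h → ¬ InCone g h d
    outside-unbalanced g h (unbalanced 0<gh few) in-cone = ℕ.<-irrefl #both
      (ℕ.≤-<-trans (count-mono both? (maybeTopRight? g h) P λ p∈P b → top-few p∈P (both⇒top b) , right-few p∈P (both⇒right b)) few)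
      where
      above-pos : ∀ p q → Above g h p q → ¬ ¬ Pos (d ∙ (q ⊟ p))
      above-pos p q (l , r) = cone-pos g h d (q ⊟ p) 0<d 0<gh in-cone (dot-<-⊟ g p q l) (dot-<-⊟ h p q r)
      top-few : ∀ {p} → p ∈ P → Top p → topRank g h p ℕ.< k ℕ.+ k
      top-few {p} p∈P t = subst (topRank g h p ℕ.<_) #top
        -- The inequality is strict because `p` itself is in `Top` but not above itself.
        (count-mono-< (above? g h p) top? P (λ {q} q∈P a →
          separates-mono Top d p q (top? q) (sep-top p∈P) (sep-top q∈P) (above-pos p q a) t) p∈P (ℤ.<-irrefl refl ∘ proj₁) t)
      right-few : ∀ {p} → p ∈ P → Right p → rightRank g h p ℕ.< m
      right-few {p} p∈P r = subst (rightRank g h p ℕ.<_) #right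
        (count-mono-< (above? g h (rot p) ∘ rot) right? P (λ {q} q∈P a →
          separates-mono Right e p q (right? q) (sep-right p∈P) (sep-right q∈P)
            -- Comparing `p` and `q` along `e` amounts to comparing `rot p` and `rot q` along `d`.
            (λ ¬pos → above-pos (rot p) (rot q) a λ pos → perpendicular-pos d e (q ⊟ p) 0<d d⊥e 0<ed
              (subst (λ v → Pos (d ∙ v)) (sym (rot-⊟ p q)) pos) ¬pos) r)
          p∈P (ℤ.<-irrefl refl ∘ proj₁) r)

-- Sets invariant under the quarter turn

orbit : List ℤ² → List ℤ²
orbit vs = vs ++ map rot vs ++ map rot (map rot vs) ++ map rot (map rot (map rot vs))

rot⁴ : ∀ v → rot (rot (rot (rot v))) ≡ v
rot⁴ (x , y) = cong₂ _,_ (ℤ.neg-involutive x) (ℤ.neg-involutive y)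

-- The turn moves each of the four blocks to the next one and, by `rot⁴`, the last to the first.
rot-orbit : ∀ vs → map rot (orbit vs) ↭ orbit vs
rot-orbit vs = ↭-trans (↭-reflexive (begin
  map rot (orbit vs)                       ≡⟨ map-++ rot vs _ ⟩
  r¹ ++ map rot (r¹ ++ r² ++ r³)           ≡⟨ cong (r¹ ++_) (map-++ rot r¹ _) ⟩
  r¹ ++ r² ++ map rot (r² ++ r³)           ≡⟨ cong (λ ws → r¹ ++ r² ++ ws) (map-++ rot r² r³) ⟩
  r¹ ++ r² ++ r³ ++ map rot r³             ≡⟨ cong (λ ws → r¹ ++ r² ++ r³ ++ ws) r⁴≡vs ⟩
  r¹ ++ r² ++ r³ ++ vs                     ≡⟨ cong (r¹ ++_) (sym (++-assoc r² r³ vs)) ⟩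
  r¹ ++ (r² ++ r³) ++ vs                   ≡⟨ sym (++-assoc r¹ (r² ++ r³) vs) ⟩
  (r¹ ++ r² ++ r³) ++ vs                   ∎))
  (++-comm (r¹ ++ r² ++ r³) vs)
  where
  open ≡-Reasoning
  r¹ = map rot vs
  r² = map rot r¹
  r³ = map rot r²
  r⁴≡vs : map rot r³ ≡ vs
  r⁴≡vs = begin
    map rot r³                                     ≡⟨ cong (map rot ∘ map rot) (map-∘ vs) ⟨
    map rot (map rot (map (rot ∘ rot) vs))         ≡⟨ cong (map rot) (map-∘ vs) ⟨
    map rot (map (rot ∘ rot ∘ rot) vs)             ≡⟨ map-∘ vs ⟨
    map (rot ∘ rot ∘ rot ∘ rot) vs                 ≡⟨ map-cong rot⁴ vs ⟩
    map (λ v → v) vs                               ≡⟨ map-id vs ⟩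
    vs                                             ∎

-- Collinearity

Independent : ℤ² → ℤ² → ℤ² → Set
Independent p q r = cross (q ⊟ p) (r ⊟ p) ≢ 0ℤ

AllTriples : (ℤ² → ℤ² → ℤ² → Set) → List ℤ² → Set
AllTriples R []       = ⊤
AllTriples R (p ∷ ps) = AllPairs (R p) ps × AllTriples R ps

allIndependent? : ∀ ps → Dec (AllTriples Independent ps)
allIndependent? []       = yes tt
allIndependent? (p ∷ ps) =
  allPairs? (λ q r → ¬? (cross (q ⊟ p) (r ⊟ p) ℤ.≟ 0ℤ)) ps ×-dec allIndependent? ps

allPairs-lookup : {R : ℤ² → ℤ² → Set} → (∀ {q r} → R q r → R r q) →
  ∀ {qs q r} → AllPairs R qs → q ∈ qs → r ∈ qs → q ≢ r → R q r
allPairs-lookup s (_ ∷ _)  (here refl) (here refl) q≢r = contradiction refl q≢r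
allPairs-lookup s (x ∷ _)  (here refl) (there r∈)  _   = All.lookup x r∈
allPairs-lookup s (x ∷ _)  (there q∈)  (here refl) _   = s (All.lookup x q∈)
allPairs-lookup s (_ ∷ xs) (there q∈)  (there r∈)  q≢r = allPairs-lookup s xs q∈ r∈ q≢r

-- Each triple is tested in one order only, with its earliest point as apex; the other orders follow
-- because collinearity is symmetric.
independent⇒noThreeCollinear : ∀ {P} → AllTriples Independent P → NoThreeCollinear P
independent⇒noThreeCollinear {x ∷ P} (ap , rest) = go
  where
  apex : ∀ {q r} → q ∈ P → r ∈ P → q ≢ r → ¬ Collinear x q r
  apex = allPairs-lookup {λ q r → ¬ Collinear x q r} (λ ¬c (ℓ , p , q , r) → ¬c (ℓ , p , r , q))
    (AllPairs.map (λ {q} {r} → cross≢0⇒¬collinear x q r) ap)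
  go : NoThreeCollinear (x ∷ P)
  go (here refl) (here refl) _           p≢q _   _   = contradiction refl p≢q
  go (here refl) (there _)   (here refl) _   _   p≢r = contradiction refl p≢r
  go (there _)   (here refl) (here refl) _   q≢r _   = contradiction refl q≢r
  go (here refl) (there q∈)  (there r∈)  _   q≢r _   = apex q∈ r∈ q≢r
  go (there p∈)  (here refl) (there r∈)  _   _   p≢r = λ (ℓ , p , q , r) → apex p∈ r∈ p≢r (ℓ , q , p , r)
  go (there p∈)  (there q∈)  (here refl) p≢q _   _   = λ (ℓ , p , q , r) → apex p∈ q∈ p≢q (ℓ , r , p , q)
  go (there p∈)  (there q∈)  (there r∈)  p≢q q≢r p≢r = independent⇒noThreeCollinear rest p∈ q∈ r∈ p≢q q≢r p≢r

-- Sectors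

Half : Sector → Sector → Set
Half u x = x ≡ u ⊎ x ≡ next u

half? : ∀ u x → Dec (Half u x)
half? u x = (x ≟ u) ⊎-dec (x ≟ next u)

next≢ : ∀ u → u ≢ next u
next≢ ⊕⊕ ()
next≢ ⊖⊕ ()
next≢ ⊖⊖ ()
next≢ ⊕⊖ ()

next⁴ : ∀ u → next (next (next (next u))) ≡ u
next⁴ ⊕⊕ = refl
next⁴ ⊖⊕ = refl
next⁴ ⊖⊖ = refl
next⁴ ⊕⊖ = refl

⟦flip⟧ : ∀ d p → ⟦ flip d ⟧ p ≐ - ⟦ d ⟧ p
⟦flip⟧ (affine a b c) (x , y) n = solve 5 (λ a b c x y →
    (:- a :* x :+ :- b :* y) :+ :- (:- c) := :- ((a :* x :+ b :* y) :+ :- c)) refl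
  (seq a n) (seq b n) (seq c n) (ι x) (ι y)

norm²-flip : ∀ d → norm² d ≐ norm² (flip d)
norm²-flip (affine a b _) n = solve 2 (λ a b → a :* a :+ b :* b := :- a :* :- a :+ :- b :* :- b) refl
  (seq a n) (seq b n)

⊙-comm : ∀ d e → d ⊙ e ≐ e ⊙ d
⊙-comm (affine a b _) (affine a′ b′ _) n = cong₂ ℚ._+_ (ℚ.*-comm (seq a n) (seq a′ n)) (ℚ.*-comm (seq b n) (seq b′ n))

⊙-flipʳ : ∀ d e → - (d ⊙ e) ≐ d ⊙ flip e
⊙-flipʳ (affine a b _) (affine a′ b′ _) n = solve 4 (λ a b a′ b′ →
    :- (a :* a′ :+ b :* b′) := a :* :- a′ :+ b :* :- b′) refl (seq a n) (seq b n) (seq a′ n) (seq b′ n)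

⊗-flipˡ : ∀ d e → - (d ⊗ e) ≐ flip d ⊗ e
⊗-flipˡ (affine a b _) (affine a′ b′ _) n = solve 4 (λ a b a′ b′ →
    :- (a :* b′ :- b :* a′) := :- a :* b′ :- :- b :* a′) refl (seq a n) (seq b n) (seq a′ n) (seq b′ n)

neg⇒<0 : ∀ x → Pos (- x) → x < 0ℝ
neg⇒<0 x (ε , 0<ε , N , h) = ε , 0<ε , N , λ n p → subst₂ ℚ._≤_
  (solve 2 (λ ε a → (con 0ℚ :+ ε) :+ a := a :+ ε) refl ε (seq x n))
  (ℚ.+-inverseˡ (seq x n)) (ℚ.+-monoˡ-≤ (seq x n) (h n p))

flip-neg : ∀ d p → Pos (- ⟦ flip d ⟧ p) → Pos (⟦ d ⟧ p)
flip-neg d p = Pos-resp-≐ { - ⟦ flip d ⟧ p} {⟦ d ⟧ p} λ n →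
  trans (cong ℚ.-_ (⟦flip⟧ d p n)) (-‿involutive (⟦ d ⟧ p) n)

opposite-half : ∀ u x → ¬ Half u x → Half (next (next u)) x
opposite-half ⊕⊕ ⊕⊕ ¬h = contradiction (inj₁ refl) ¬h
opposite-half ⊕⊕ ⊖⊕ ¬h = contradiction (inj₂ refl) ¬h
opposite-half ⊕⊕ ⊖⊖ _  = inj₁ refl
opposite-half ⊕⊕ ⊕⊖ _  = inj₂ refl
opposite-half ⊖⊕ ⊖⊕ ¬h = contradiction (inj₁ refl) ¬h
opposite-half ⊖⊕ ⊖⊖ ¬h = contradiction (inj₂ refl) ¬h
opposite-half ⊖⊕ ⊕⊖ _  = inj₁ refl
opposite-half ⊖⊕ ⊕⊕ _  = inj₂ refl
opposite-half ⊖⊖ ⊖⊖ ¬h = contradiction (inj₁ refl) ¬h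
opposite-half ⊖⊖ ⊕⊖ ¬h = contradiction (inj₂ refl) ¬h
opposite-half ⊖⊖ ⊕⊕ _  = inj₁ refl
opposite-half ⊖⊖ ⊖⊕ _  = inj₂ refl
opposite-half ⊕⊖ ⊕⊖ ¬h = contradiction (inj₁ refl) ¬h
opposite-half ⊕⊖ ⊕⊕ ¬h = contradiction (inj₂ refl) ¬h
opposite-half ⊕⊖ ⊖⊕ _  = inj₁ refl
opposite-half ⊕⊖ ⊖⊖ _  = inj₂ refl

module _ (ℓ₁ ℓ₂ : Line) where

  private
    d₁ d₂ : Affine
    d₁ = toAffine ℓ₁
    d₂ = toAffine ℓ₂

  -- The affine functional whose positive side is the union of the sectors u and next u.
  side : Sector → Affine
  side ⊕⊕ = d₂
  side ⊖⊕ = flip d₁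
  side ⊖⊖ = flip d₂
  side ⊕⊖ = d₁

  side-norm² : ∀ u → ¬ ¬ Pos (norm² (side u))
  side-norm² ⊕⊕ = norm²-pos ℓ₂
  side-norm² ⊖⊕ = λ n → norm²-pos ℓ₁ (n ∘ Pos-resp-≐ {norm² d₁} {norm² (flip d₁)} (norm²-flip d₁))
  side-norm² ⊖⊖ = λ n → norm²-pos ℓ₂ (n ∘ Pos-resp-≐ {norm² d₂} {norm² (flip d₂)} (norm²-flip d₂))
  side-norm² ⊕⊖ = norm²-pos ℓ₁

  side-closed : ∀ u x p → Half u x → InClosedSector ℓ₁ ℓ₂ x p → ¬ Pos (- ⟦ side u ⟧ p)
  side-closed ⊕⊕ _ p (inj₁ refl) (_ , b) = b ∘ neg⇒<0 (⟦ d₂ ⟧ p)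
  side-closed ⊕⊕ _ p (inj₂ refl) (_ , b) = b ∘ neg⇒<0 (⟦ d₂ ⟧ p)
  side-closed ⊖⊕ _ p (inj₁ refl) (a , _) = a ∘ flip-neg d₁ p
  side-closed ⊖⊕ _ p (inj₂ refl) (a , _) = a ∘ flip-neg d₁ p
  side-closed ⊖⊖ _ p (inj₁ refl) (_ , b) = b ∘ flip-neg d₂ p
  side-closed ⊖⊖ _ p (inj₂ refl) (_ , b) = b ∘ flip-neg d₂ p
  side-closed ⊕⊖ _ p (inj₁ refl) (a , _) = a ∘ neg⇒<0 (⟦ d₁ ⟧ p)
  side-closed ⊕⊖ _ p (inj₂ refl) (a , _) = a ∘ neg⇒<0 (⟦ d₁ ⟧ p)

  ⟦side⟧-opposite : ∀ u p → - ⟦ side (next (next u)) ⟧ p ≐ ⟦ side u ⟧ p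
  ⟦side⟧-opposite ⊕⊕ p n = trans (cong ℚ.-_ (⟦flip⟧ d₂ p n)) (-‿involutive (⟦ d₂ ⟧ p) n)
  ⟦side⟧-opposite ⊖⊕ p n = sym (⟦flip⟧ d₁ p n)
  ⟦side⟧-opposite ⊖⊖ p n = sym (⟦flip⟧ d₂ p n)
  ⟦side⟧-opposite ⊕⊖ p n = trans (cong ℚ.-_ (⟦flip⟧ d₁ p n)) (-‿involutive (⟦ d₁ ⟧ p) n)

  side-⊗-opposite : ∀ u d → - (side u ⊗ d) ≐ side (next (next u)) ⊗ d
  side-⊗-opposite ⊕⊕ d n = ⊗-flipˡ d₂ d n
  side-⊗-opposite ⊖⊕ d n = trans (cong ℚ.-_ (sym (⊗-flipˡ d₁ d n))) (-‿involutive (d₁ ⊗ d) n)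
  side-⊗-opposite ⊖⊖ d n = trans (cong ℚ.-_ (sym (⊗-flipˡ d₂ d n))) (-‿involutive (d₂ ⊗ d) n)
  side-⊗-opposite ⊕⊖ d n = ⊗-flipˡ d₁ d n

  -- A sector outside the half of `u` lies in the opposite half, whose functional is the negative
  -- one, so both claims reduce to `side-closed`.
  side-separates : ∀ u x p → InClosedSector ℓ₁ ℓ₂ x p →
    (Half u x → ¬ Pos (- ⟦ side u ⟧ p)) × (¬ Half u x → ¬ Pos (⟦ side u ⟧ p))
  side-separates u x p cl = (λ h → side-closed u x p h cl) , λ ¬h →
    side-closed (next (next u)) x p (opposite-half u x ¬h) cl ∘
      Pos-resp-≐ {⟦ side u ⟧ p} { - ⟦ side (next (next u)) ⟧ p} (λ n → sym (⟦side⟧-opposite u p n))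

  module _ (ℓ₁⊥ℓ₂ : Perpendicular ℓ₁ ℓ₂) where

    side-⊥ : ∀ u → side u ⊙ side (next u) ≈ 0ℝ
    side-⊥ ⊕⊕ = ≈0-resp-≐ { - (d₂ ⊙ d₁)} {d₂ ⊙ flip d₁} (⊙-flipʳ d₂ d₁) (≈0-neg (d₂ ⊙ d₁) ℓ₂⊥ℓ₁)
      where
      ℓ₂⊥ℓ₁ : d₂ ⊙ d₁ ≈ 0ℝ
      ℓ₂⊥ℓ₁ = ≈0-resp-≐ {d₁ ⊙ d₂} {d₂ ⊙ d₁} (⊙-comm d₁ d₂) ℓ₁⊥ℓ₂
    side-⊥ ⊖⊕ = ≈0-resp-≐ {d₁ ⊙ d₂} {flip d₁ ⊙ flip d₂} (λ n → trans (sym (-‿involutive (d₁ ⊙ d₂) n))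
        (trans (cong ℚ.-_ (trans (⊙-flipʳ d₁ d₂ n) (⊙-comm d₁ (flip d₂) n)))
          (trans (⊙-flipʳ (flip d₂) d₁ n) (⊙-comm (flip d₂) (flip d₁) n)))) ℓ₁⊥ℓ₂
    side-⊥ ⊖⊖ = ≈0-resp-≐ { - (d₁ ⊙ d₂)} {flip d₂ ⊙ d₁}
        (λ n → trans (⊙-flipʳ d₁ d₂ n) (⊙-comm d₁ (flip d₂) n)) (≈0-neg (d₁ ⊙ d₂) ℓ₁⊥ℓ₂)
    side-⊥ ⊕⊖ = ℓ₁⊥ℓ₂

-- Covering all directions by four quarters

-‿∙-rot² : ∀ d v → - (d ∙ rot (rot v)) ≐ d ∙ v
-‿∙-rot² (affine a b _) (x , y) n rewrite /1-homo‿- x | /1-homo‿- y =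
  solve 4 (λ a b x y → :- (a :* :- x :+ b :* :- y) := a :* x :+ b :* y) refl (seq a n) (seq b n) (ι x) (ι y)

unrot-rot : ∀ v → unrot (rot v) ≡ v
unrot-rot (x , y) = cong (x ,_) (ℤ.neg-involutive y)

-- `d` is nonnegative on `g` or on its opposite, and likewise for `rot g`; the four combinations
-- place `d` in the four quarters. The signs are not decidable, so `either` states each alternative
-- in negated form.
quarter-cover : ∀ d g →
  ¬ InCone g (rot g) d → ¬ InCone (rot g) (rot (rot g)) d →
  ¬ InCone (rot (rot g)) (rot (rot (rot g))) d → ¬ InCone (rot (rot (rot g))) (rot (rot (rot (rot g)))) d → ⊥
quarter-cover d g ¬0 ¬1 ¬2 ¬3 =
  either g
    (λ n₀ → either (rot g) (λ n₁ → ¬0 (in-cone g n₁ n₀))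
                           (λ n₃ → ¬3 (in-cone (rot (rot (rot g))) (subst NonNeg (sym (rot⁴ g)) n₀) n₃)))
    (λ n₂ → either (rot g) (λ n₁ → ¬1 (in-cone (rot g) n₂ n₁))
                           (λ n₃ → ¬2 (in-cone (rot (rot g)) n₃ n₂)))
  where
  NonNeg : ℤ² → Set
  NonNeg v = ¬ Pos (- (d ∙ v))
  either : ∀ v → ¬ NonNeg v → ¬ ¬ NonNeg (rot (rot v))
  either v ¬n ¬n″ = ¬n λ neg → ¬n″ λ neg″ → pos-asym (d ∙ v)
    (Pos-resp-≐ { - (d ∙ rot (rot v))} {d ∙ v} (-‿∙-rot² d v) neg″) neg
  in-cone : ∀ v → NonNeg (rot v) → NonNeg v → InCone v (rot v) d
  in-cone v n₁ n₀ = n₁ , subst NonNeg (sym (unrot-rot v)) n₀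

-- Excluding weak and strict partitions

count-half : ∀ P σ u → count (λ p → half? u (σ p)) P ≡ classSize P σ u ℕ.+ classSize P σ (next u)
count-half P σ u = count-⊎ (λ p → σ p ≟ u) (λ p → σ p ≟ next u) (λ e e′ → next≢ u (trans (sym e) e′)) P

module _ (P : List ℤ²) (m k : ℕ) (k≤m : k ℕ.≤ m) (rot-P : map rot P ↭ P)
  (g : ℤ²) (fan₀ : TransClosure (Unbalanced P m k) g (rot g)) where

  outside⇒⊥ : ∀ d → (∀ g h → Unbalanced P m k g h → ¬ InCone g h d) → ⊥
  outside⇒⊥ d outside = quarter-cover d g
    (outside-fan P m k d outside fan₀) (outside-fan P m k d outside fan₁)
    (outside-fan P m k d outside fan₂) (outside-fan P m k d outside fan₃)
    where
    fan₁ = fan-rot P m k rot-P fan₀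
    fan₂ = fan-rot P m k rot-P fan₁
    fan₃ = fan-rot P m k rot-P fan₂

  noWeakPartition : ¬ HasWeakOrthogonalPartition P m k
  noWeakPartition (ℓ₁ , ℓ₂ , σ , ⊥ℓ , closed , s , #₀ , #₁ , #₂ , #₃) =
    side-norm² ℓ₁ ℓ₂ s λ 0<d → side-norm² ℓ₁ ℓ₂ (next s) λ 0<e →
      -- The signs of the given equations are arbitrary, so `next` may run either way around. If `e`
      -- is clockwise from `d`, the small class on both positive sides is `next s`; otherwise `e` is
      -- replaced by its opposite `e′`, and that class is `s`.
      perpendicular-oriented d e 0<d 0<e (side-⊥ ℓ₁ ℓ₂ ⊥ℓ s)
        (λ 0<ed → outside⇒⊥ d (outside-unbalanced P m k
          (λ p → half? s (σ p)) (λ p → half? (next s) (σ p)) (λ p → σ p ≟ next s) inj₂ inj₁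
          #top (trans (count-half P σ (next s)) (trans (cong₂ ℕ._+_ #₁ #₂) (ℕ.m+[n∸m]≡n k≤m))) #₁
          d e 0<d (side-⊥ ℓ₁ ℓ₂ ⊥ℓ s) 0<ed (separates s) (separates (next s))))
        (λ ed<0 → outside⇒⊥ d (outside-unbalanced P m k
          (λ p → half? s (σ p)) (λ p → half? (next (next (next s))) (σ p)) (λ p → σ p ≟ s)
          inj₁ (λ e → inj₂ (trans e (sym (next⁴ s))))
          #top #right′ #₀
          d e′ 0<d
          (≈0-resp-≐ {e′ ⊙ d} {d ⊙ e′} (⊙-comm e′ d)
            (subst (λ u → e′ ⊙ side ℓ₁ ℓ₂ u ≈ 0ℝ) (next⁴ s) (side-⊥ ℓ₁ ℓ₂ ⊥ℓ (next (next (next s))))))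
          (Pos-resp-≐ { - (e ⊗ d)} {e′ ⊗ d} (side-⊗-opposite ℓ₁ ℓ₂ (next s) d) ed<0)
          (separates s) (separates (next (next (next s))))))
    where
    d = side ℓ₁ ℓ₂ s
    e = side ℓ₁ ℓ₂ (next s)
    e′ = side ℓ₁ ℓ₂ (next (next (next s)))
    separates : ∀ u {p} → p ∈ P → Separates (side ℓ₁ ℓ₂ u) (λ p → Half u (σ p)) p
    separates u {p} p∈P = side-separates ℓ₁ ℓ₂ u (σ p) p (closed p∈P)
    #top : count (λ p → half? s (σ p)) P ≡ k ℕ.+ k
    #top = trans (count-half P σ s) (cong₂ ℕ._+_ #₀ #₁)
    #right′ : count (λ p → half? (next (next (next s))) (σ p)) P ≡ m
    #right′ = trans (count-half P σ (next (next (next s))))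
      (trans (cong₂ ℕ._+_ #₃ (trans (cong (classSize P σ) (next⁴ s)) #₀)) (ℕ.m∸n+n≡m k≤m))

<⇒≤ : ∀ x y → x < y → x ≤ y
<⇒≤ x y (ε , 0<ε , N , h) (δ , 0<δ , M , g) = ℚ.<-asym (step 0<ε (h n (ℕ.m≤m⊔n N M))) (step 0<δ (g n (ℕ.m≤n⊔m N M)))
  where
  n = N ⊔ M
  step : ∀ {ε p q} → 0ℚ ℚ.< ε → p ℚ.+ ε ℚ.≤ q → p ℚ.< q
  step {ε} {p} 0<ε p+ε≤q = ℚ.<-≤-trans (subst (ℚ._< p ℚ.+ ε) (ℚ.+-identityʳ p) (ℚ.+-monoʳ-< p 0<ε)) p+ε≤q

open⇒closed : ∀ ℓ₁ ℓ₂ s p → InOpenSector ℓ₁ ℓ₂ s p → InClosedSector ℓ₁ ℓ₂ s p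
open⇒closed ℓ₁ ℓ₂ ⊕⊕ p (a , b) = <⇒≤ 0ℝ (eval ℓ₁ p) a , <⇒≤ 0ℝ (eval ℓ₂ p) b
open⇒closed ℓ₁ ℓ₂ ⊖⊕ p (a , b) = <⇒≤ (eval ℓ₁ p) 0ℝ a , <⇒≤ 0ℝ (eval ℓ₂ p) b
open⇒closed ℓ₁ ℓ₂ ⊖⊖ p (a , b) = <⇒≤ (eval ℓ₁ p) 0ℝ a , <⇒≤ (eval ℓ₂ p) 0ℝ b
open⇒closed ℓ₁ ℓ₂ ⊕⊖ p (a , b) = <⇒≤ 0ℝ (eval ℓ₁ p) a , <⇒≤ (eval ℓ₂ p) 0ℝ b

orthogonal⇒weak : ∀ {P m k} → HasOrthogonalPartition P m k → HasWeakOrthogonalPartition P m k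
orthogonal⇒weak (ℓ₁ , ℓ₂ , σ , ⊥ℓ , open-sector , sizes) =
  ℓ₁ , ℓ₂ , σ , ⊥ℓ , (λ {p} p∈P → open⇒closed ℓ₁ ℓ₂ (σ p) p (open-sector p∈P)) , sizes

-- The point set and its verification by evaluation

-- Found by simulated annealing over sets invariant under the quarter turn.
base : List ℤ²
base =
  (+ 15 , + 556) ∷ (+ 94 , + 2728) ∷ (+ 230 , + 580) ∷ (+ 242 , + 2134) ∷
  (+ 244 , + 834) ∷ (+ 248 , + 833) ∷ (+ 520 , + 370) ∷ (+ 614 , + 1098) ∷
  (+ 618 , + 1103) ∷ (+ 632 , + 2830) ∷ (+ 745 , + 365) ∷ (+ 861 , + 67) ∷
  (+ 894 , + 441) ∷ (+ 903 , + 446) ∷ (+ 911 , + 447) ∷ (+ 915 , + 430) ∷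
  (+ 916 , + 447) ∷ (+ 919 , + 383) ∷ (+ 924 , + 436) ∷ (+ 925 , + 375) ∷
  (+ 2516 , + 22) ∷ (+ 3070 , + 47) ∷ (+ 4463 , + 906) ∷ (+ 4474 , + 922) ∷
  []

points : List ℤ²
points = orbit base

points-unique : Unique points
points-unique = from-yes (allPairs? (λ p q → ¬? (≡-dec ℤ._≟_ ℤ._≟_ p q)) points)

-- The central symmetry is the quarter turn applied twice.
points-centrallySymmetric : CentrallySymmetric points
points-centrallySymmetric v∈ = rot-closed (rot-closed v∈)
  where
  rot-closed : ∀ {v} → v ∈ points → rot v ∈ points
  rot-closed v∈ = ∈-resp-↭ (rot-orbit base) (∈-map⁺ rot v∈)

points-noThreeCollinear : NoThreeCollinear points
points-noThreeCollinear = independent⇒noThreeCollinear (from-yes (allIndependent? points))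

-- The rays have slopes from -1 to 1 in multiples of 1/256. The last ray is `rot` of the first, so
-- the turned copies of the fan close up around the origin.
points-fan : TransClosure (Unbalanced points 48 8) (+ 256 , ℤ.- + 256) (+ 256 , + 256)
points-fan =
  from-yes (unbalanced? points 48 8 (+ 256 , ℤ.- + 256) (+ 256 , ℤ.- + 145)) ∷
  from-yes (unbalanced? points 48 8 (+ 256 , ℤ.- + 145) (+ 256 , ℤ.- + 77)) ∷
  from-yes (unbalanced? points 48 8 (+ 256 , ℤ.- + 77) (+ 256 , ℤ.- + 58)) ∷
  from-yes (unbalanced? points 48 8 (+ 256 , ℤ.- + 58) (+ 256 , ℤ.- + 30)) ∷
  from-yes (unbalanced? points 48 8 (+ 256 , ℤ.- + 30) (+ 256 , + 2)) ∷
  from-yes (unbalanced? points 48 8 (+ 256 , + 2) (+ 256 , + 51)) ∷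
  from-yes (unbalanced? points 48 8 (+ 256 , + 51) (+ 256 , + 103)) ∷
  from-yes (unbalanced? points 48 8 (+ 256 , + 103) (+ 256 , + 120)) ∷
  [ from-yes (unbalanced? points 48 8 (+ 256 , + 120) (+ 256 , + 256)) ]

points-noWeakPartition : ¬ HasWeakOrthogonalPartition points 48 8
points-noWeakPartition = noWeakPartition points 48 8 (ℕ.m≤m+n 8 40) (rot-orbit base) (+ 256 , ℤ.- + 256) points-fan

theorem1p6 : ∃[ P ] ( length {A = ℤ²} P ≡ 96
    × Unique P
    × CentrallySymmetric P
    × NoThreeCollinear P
    × ¬ HasOrthogonalPartition P 48 8
    × ¬ HasWeakOrthogonalPartition P 48 8 )
theorem1p6 = points , refl , points-unique , points-centrallySymmetric , points-noThreeCollinear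
  , points-noWeakPartition ∘ orthogonal⇒weak {points} {48} {8} , points-noWeakPartition
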